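{- Let $\Phi$ be a clean root system of rank $3$ with Weyl (Coxeter) group $W$, and let $\overline{\Phi}$ be its set of rays with involution $\ast$ given by negation. Then $\Phi$ has a unique oriented matroid root system structure; that is, there is exactly one closure operator $d$ on $\overline{\Phi}$ such that $(\overline{\Phi},\ast,d)$ is an oriented matroid root system for $W$.
   Context: **Root systems.** Let $V$ be a finite-dimensional real vector space with a symmetric bilinear form $(\cdot,\cdot)$, and let $\Pi\subset V$ be a finite set (the simple roots) which is positively independent (a linear combination of $\Pi$ with nonnegative coefficients is $0$ only if all coefficients are $0$), with $(\alpha,\alpha)>0$ for $\alpha\in\Pi$, and with $\frac{(\alpha,\beta)}{\sqrt{(\alpha,\alpha)(\beta,\beta)}}\in\{ -\cos(\pi/m): m\in\mathbb{Z}_{\ge2}\}\cup(-\infty,-1]$ for distinct $\alpha,\beta\in\Pi$. Let $s_\alpha(v)=v-2\frac{(v,\alpha)}{(\alpha,\alpha)}\alpha$, $S=\{s_\alpha:\alpha\in\Pi\}$, $W=\langle S\rangle$ (then $(W,S)$ is a Coxeter system), $\Phi=W\Pi$ (a root system with base $\Pi$), $\Phi^+=\Phi\cap\operatorname{cone}(\Pi)$, so $\Phi=\Phi^+\sqcup-\Phi^+$. The rank of $\Phi$ is $|\Pi|=|S|$. Here $\operatorname{cone}(A)$ is the set of finite nonnegative real linear combinations of elements of $A$ (so $\operatorname{cone}(\varnothing)=\{0\}$). **Reduction.** $\overline{\Phi}$ is the quotient of $\Phi$ identifying roots that are positive scalar multiples of each other (i.e. the set of rays spanned by roots); $\overline{\alpha}$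 is the class of $\alpha$, $\overline{\Phi}^+$ is the image of $\Phi^+$, the involution $\ast$ on $\overline{\Phi}$ is $\overline{\alpha}\mapsto\overline{ -\alpha}$, and $W$ acts on $\overline{\Phi}$. For $X\subseteq\overline{\Phi}$, $\operatorname{cone}_\Phi(X)$ is the set of elements of $\overline{\Phi}$ whose representatives lie in the cone generated by representatives of $X$. **Oriented matroids.** An oriented matroid is a triple $(E,\ast,\mathrm{cx})$ where $E$ is a (possibly infinite) set, $\ast:E\to E$ is a fixed-point-free involution, and $\mathrm{cx}$ is a closure operator on subsets of $E$ such that for all $X\subseteq E$ and $x,y\in E$: (1) $\mathrm{cx}(X)^\ast=\mathrm{cx}(X^\ast)$; (2) if $x\in\mathrm{cx}(X\cup\{x^\ast\})$ then $x\in\mathrm{cx}(X)$; (3) if $x\in\mathrm{cx}(X\cup\{y^\ast\})$ and $x\notin\mathrm{cx}(X)$ then $y\in\mathrm{cx}((X\setminus\{y\})\cup\{x^\ast\})$; (4) if $x\in\mathrm{cx}(X)$ then $x\in\mathrm{cx}(Y)$ for some finite $Y\subseteq X$. It is reduced if $\mathrm{cx}(\varnothing)=\varnothing$ and $\mathrm{cx}(\{x\})=\{x\}$ for all $x\in E$. A set $X\subseteq E$ is asymmetric if $X\cap X^\ast=\varnothing$; a tope is a set that is maximal (under inclusion) among asymmetric sets $X$ with $\mathrm{cx}(X)=X$. A set $R\subseteq E$ is topal if $|R\cap\{x,x^\ast\}|=1$ for all $x\in E$. **Oriented matroid root systems.** An oriented matroid root system (OMRS) for $W$ is a reduced oriented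 matroid $(\overline{\Phi},\ast,d)$ such that: (i) $d(wX)=w\,d(X)$ for all $X\subseteq\overline{\Phi}$, $w\in W$; (ii) $d(\overline{\Phi}^+)=\overline{\Phi}^+$; (iii) if $X\subseteq\overline{\Phi}$ has linear span of dimension at most $2$, then $d(X)=\operatorname{cone}_\Phi(X)$. **Cleanness.** A set $B\subseteq\Phi^+$ is $c_2$-closed in $\Phi^+$ if whenever $\alpha,\beta\in B$ and $\gamma\in\Phi^+$ is a nonnegative linear combination of $\alpha$ and $\beta$, then $\gamma\in B$; $B$ is $c_2$-biclosed in $\Phi^+$ if both $B$ and $\Phi^+\setminus B$ are $c_2$-closed in $\Phi^+$. A topal set $R\subseteq\overline{\Phi}$ is a quasitope if $\{\alpha\in\Phi^+:\overline{\alpha}\in R\}$ is $c_2$-biclosed in $\Phi^+$. The root system $\Phi$ is clean if every quasitope is a tope of the oriented matroid $(\overline{\Phi},\ast,\operatorname{cone}_\Phi)$. -}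

module Defs where

open import Algebra.Bundles using (CommutativeRing; Semiring)
import Algebra.Definitions as AlgebraDefinitions
import Algebra.Definitions.RawMonoid as RawMonoidDefinitions
import Algebra.Definitions.RawSemiring as RawSemiringDefinitions
open import Algebra.Module.Bundles using (LeftModule)
import Algebra.Module.Properties.LeftModule as LeftModuleProperties
import Algebra.Properties.Ring as RingProperties
open import Data.Empty.Polymorphic using (⊥)
open import Data.Fin.Base using (Fin)
open import Data.List.Base using (List; []; _∷_; _++_; [_])
open import Data.List.Relation.Unary.All using (All)
import Data.List.Membership.Setoid as ListMembership
open import Data.List.Membership.Setoid.Properties using (∈-resp-≈)
open import Data.Nat.Base as ℕ using (ℕ; zero; suc; _!)
open import Data.Product using (∃; Σ; _×_; _,_; proj₁; proj₂; ∃-syntax)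
open import Data.Sum.Base as Sum using (_⊎_; inj₁; inj₂)
open import Data.Unit.Polymorphic using (⊤)
open import Function.Base using (_∘_)
open import Level using (Level) renaming (suc to lsuc)
open import Relation.Binary.Bundles using (Setoid)
open import Relation.Binary.Core using (Rel)
open import Relation.Binary.Definitions using (_Respects_; Reflexive; Symmetric; Transitive)
open import Relation.Binary.PropositionalEquality.Core using (_≡_)
import Relation.Binary.Reasoning.Setoid as SetoidReasoning
open import Relation.Binary.Structures using (IsTotalOrder)
open import Relation.Nullary.Negation using (¬_; contradiction)
open import Relation.Unary using (Pred)
import Relation.Unary as Unary

-- The real numbers, given axiomatically as a Dedekind complete ordered field
-- (classically unique up to isomorphism).  The inverse is a total function
-- whose value at 0 is unspecified and never used.

record RealNumbers (ℓ : Level) : Set (lsuc ℓ) where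
  infix 4 _≤_ _<_
  infix 9 _⁻¹
  field
    commutativeRing : CommutativeRing ℓ ℓ
  open CommutativeRing commutativeRing public
  field
    _≤_          : Rel Carrier ℓ
    isTotalOrder : IsTotalOrder _≈_ _≤_
    0≉1          : ¬ 0# ≈ 1#
    _⁻¹          : Carrier → Carrier
    ⁻¹-inverseʳ  : ∀ x → ¬ x ≈ 0# → x * x ⁻¹ ≈ 1#
    +-monoˡ-≤    : ∀ x {y z} → y ≤ z → y + x ≤ z + x
    *-nonneg     : ∀ {x y} → 0# ≤ x → 0# ≤ y → 0# ≤ x * y

  UpperBound : Pred Carrier ℓ → Pred Carrier ℓ
  UpperBound P u = ∀ x → P x → x ≤ u

  field
    supremum : (P : Pred Carrier ℓ) → ∃ P → ∃ (UpperBound P) →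
               ∃[ s ] (UpperBound P s × (∀ u → UpperBound P u → s ≤ u))

  _<_ : Rel Carrier ℓ
  x < y = x ≤ y × ¬ x ≈ y

module RealAnalysis {ℓ} (ℝ : RealNumbers ℓ) where
  open RealNumbers ℝ
  open RawSemiringDefinitions (Semiring.rawSemiring semiring) using (_^_) renaming (_×_ to _·_)

  Converges : (ℕ → Carrier) → Carrier → Set ℓ
  Converges s l = ∀ ε → 0# < ε →
    ∃[ N ] (∀ n → N ℕ.≤ n → (l - ε < s n) × (s n < l + ε))

  cosPartialSum : Carrier → ℕ → Carrier
  cosPartialSum x zero    = 0#
  cosPartialSum x (suc n) =
    cosPartialSum x n
      + (- 1#) ^ n * x ^ (2 ℕ.* n) * (((2 ℕ.* n) !) · 1#) ⁻¹

  -- IsCos x c  means  cos x = c.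
  IsCos : Carrier → Carrier → Set ℓ
  IsCos x = Converges (cosPartialSum x)

  -- π / 2 is the least nonnegative zero of the cosine.
  IsPi : Carrier → Set ℓ
  IsPi p = 0# < p
         × IsCos (p * (2 · 1#) ⁻¹) 0#
         × (∀ y → 0# ≤ y → y < p * (2 · 1#) ⁻¹ → ¬ IsCos y 0#)

  -- IsCosπ/ m c  means  cos (π / m) = c.
  IsCosπ/ : ℕ → Carrier → Set ℓ
  IsCosπ/ m c = ∃[ p ] (IsPi p × IsCos (p * (m · 1#) ⁻¹) c)

  IsSqrt : Carrier → Carrier → Set ℓ
  IsSqrt x r = 0# ≤ r × r * r ≈ x

module OrderedFieldProperties {ℓ} (ℝ : RealNumbers ℓ) where
  open RealNumbers ℝ
  open RingProperties ring
  open IsTotalOrder isTotalOrder using (total; antisym; ≤-respˡ-≈; ≤-respʳ-≈)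
  open SetoidReasoning setoid

  x≤0⇒0≤-x : ∀ {x} → x ≤ 0# → 0# ≤ - x
  x≤0⇒0≤-x {x} x≤0 =
    ≤-respˡ-≈ (-‿inverseʳ x) (≤-respʳ-≈ (+-identityˡ (- x)) (+-monoˡ-≤ (- x) x≤0))

  0<1 : 0# < 1#
  0<1 with total 0# 1#
  ... | inj₁ 0≤1 = 0≤1 , 0≉1
  ... | inj₂ 1≤0 = ≤-respʳ-≈ -1*-1≈1 (*-nonneg 0≤-1 0≤-1) , 0≉1
    where
    0≤-1 : 0# ≤ - 1#
    0≤-1 = x≤0⇒0≤-x 1≤0
    -1*-1≈1 : - 1# * - 1# ≈ 1#
    -1*-1≈1 = trans (-1*x≈-x (- 1#)) (-‿involutive 1#)

  *-pos : ∀ {x y} → 0# < x → 0# < y → 0# < x * y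
  *-pos {x} {y} (0≤x , 0≉x) (0≤y , 0≉y) = *-nonneg 0≤x 0≤y , λ 0≈xy → 0≉y (sym (begin
    y               ≈⟨ *-identityˡ y ⟨
    1# * y          ≈⟨ *-congʳ (⁻¹-inverseʳ x (0≉x ∘ sym)) ⟨
    x * x ⁻¹ * y    ≈⟨ *-congʳ (*-comm x (x ⁻¹)) ⟩
    x ⁻¹ * x * y    ≈⟨ *-assoc (x ⁻¹) x y ⟩
    x ⁻¹ * (x * y)  ≈⟨ *-congˡ 0≈xy ⟨
    x ⁻¹ * 0#       ≈⟨ zeroʳ (x ⁻¹) ⟩
    0#              ∎))

  ⁻¹-pos : ∀ {x} → 0# < x → 0# < x ⁻¹
  ⁻¹-pos {x} (0≤x , 0≉x) = nonneg , λ 0≈x⁻¹ →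
    0≉1 (trans (sym (zeroʳ x)) (trans (*-congˡ 0≈x⁻¹) xx⁻¹≈1))
    where
    xx⁻¹≈1 : x * x ⁻¹ ≈ 1#
    xx⁻¹≈1 = ⁻¹-inverseʳ x (0≉x ∘ sym)
    nonneg : 0# ≤ x ⁻¹
    nonneg with total 0# (x ⁻¹)
    ... | inj₁ 0≤x⁻¹ = 0≤x⁻¹
    ... | inj₂ x⁻¹≤0 = contradiction (antisym (proj₁ 0<1) 1≤0) 0≉1
      where
      0≤-1 : 0# ≤ - 1#
      0≤-1 = ≤-respʳ-≈ (trans (sym (-‿distribʳ-* x (x ⁻¹))) (-‿cong xx⁻¹≈1))
               (*-nonneg 0≤x (x≤0⇒0≤-x x⁻¹≤0))
      1≤0 : 1# ≤ 0#
      1≤0 = ≤-respˡ-≈ (+-identityˡ 1#) (≤-respʳ-≈ (-‿inverseˡ 1#) (+-monoˡ-≤ 1# 0≤-1))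

module VectorSpace {ℓ} (ℝ : RealNumbers ℓ)
                   (V : LeftModule (RealNumbers.ring ℝ) ℓ ℓ) where
  open RealNumbers ℝ
  open LeftModule V
  open RawMonoidDefinitions +ᴹ-rawMonoid using (sum)

  combination : ∀ {n} → (Fin n → Carrier) → (Fin n → Carrierᴹ) → Carrierᴹ
  combination c v = sum (λ i → c i *ₗ v i)

  range : ∀ {n} → (Fin n → Carrierᴹ) → Pred Carrierᴹ ℓ
  range b v = ∃[ i ] (v ≈ᴹ b i)

  span : Pred Carrierᴹ ℓ → Pred Carrierᴹ ℓ
  span A v = ∃[ n ] Σ (Fin n → Carrier) λ c → Σ (Fin n → Carrierᴹ) λ a →
    (∀ i → A (a i)) × v ≈ᴹ combination c a

  cone : Pred Carrierᴹ ℓ → Pred Carrierᴹ ℓ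
  cone A v = ∃[ n ] Σ (Fin n → Carrier) λ c → Σ (Fin n → Carrierᴹ) λ a →
    (∀ i → 0# ≤ c i) × (∀ i → A (a i)) × v ≈ᴹ combination c a

  LinearlyIndependent : ∀ {n} → (Fin n → Carrierᴹ) → Set ℓ
  LinearlyIndependent b = ∀ c → combination c b ≈ᴹ 0ᴹ → ∀ i → c i ≈ 0#

  PositivelyIndependent : ∀ {n} → (Fin n → Carrierᴹ) → Set ℓ
  PositivelyIndependent b =
    ∀ c → (∀ i → 0# ≤ c i) → combination c b ≈ᴹ 0ᴹ → ∀ i → c i ≈ 0#

  HasDimension : Pred Carrierᴹ ℓ → ℕ → Set ℓ
  HasDimension A k = Σ (Fin k → Carrierᴹ) λ b →
    LinearlyIndependent b × A Unary.≐ span (range b)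

  FiniteDimensional : Set ℓ
  FiniteDimensional = ∃[ k ] HasDimension (λ _ → ⊤) k

-- The simple roots are a family indexed by Fin rank; angles forces distinct
-- indices to give distinct vectors.

record RootSystem {ℓ} (ℝ : RealNumbers ℓ) : Set (lsuc ℓ) where
  open RealNumbers ℝ
  open RealAnalysis ℝ
  field
    V : LeftModule ring ℓ ℓ
  open LeftModule V public
  open VectorSpace ℝ V public
  field
    finiteDimensional : FiniteDimensional

    ⟨_∣_⟩  : Carrierᴹ → Carrierᴹ → Carrier
    ⟨⟩-cong : ∀ {u u′ v v′} → u ≈ᴹ u′ → v ≈ᴹ v′ → ⟨ u ∣ v ⟩ ≈ ⟨ u′ ∣ v′ ⟩
    ⟨⟩-sym  : ∀ u v → ⟨ u ∣ v ⟩ ≈ ⟨ v ∣ u ⟩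
    ⟨⟩-+ˡ   : ∀ u u′ v → ⟨ u +ᴹ u′ ∣ v ⟩ ≈ ⟨ u ∣ v ⟩ + ⟨ u′ ∣ v ⟩
    ⟨⟩-*ˡ   : ∀ a u v → ⟨ a *ₗ u ∣ v ⟩ ≈ a * ⟨ u ∣ v ⟩

    rank   : ℕ
    simple : Fin rank → Carrierᴹ
    positivelyIndependent : PositivelyIndependent simple
    simple-pos : ∀ i → 0# < ⟨ simple i ∣ simple i ⟩
    -- r is √((α,α)(β,β)) and t is (α,β)/r.
    angles : ∀ i j → ¬ i ≡ j →
      ∃[ r ] ∃[ t ]
        ( IsSqrt (⟨ simple i ∣ simple i ⟩ * ⟨ simple j ∣ simple j ⟩) r
        × ⟨ simple i ∣ simple j ⟩ ≈ t * r
        × ( (∃[ m ] ∃[ c ] (2 ℕ.≤ m × IsCosπ/ m c × t ≈ - c))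
          ⊎ t ≤ - 1#))

  reflect : Carrierᴹ → Carrierᴹ → Carrierᴹ
  reflect α v = v +ᴹ -ᴹ (((1# + 1#) * ⟨ v ∣ α ⟩ * ⟨ α ∣ α ⟩ ⁻¹) *ₗ α)

-- Subsets of a setoid respect its equality.

module Subsets {ℓ} (E : Setoid ℓ ℓ) where
  open Setoid E
  private module ListE = ListMembership E

  infix 4 _∈_ _∉_ _⊆_ _≐_
  infixl 6 _∪_
  infixl 7 _∖_

  record Subset : Set (lsuc ℓ) where
    field
      member  : Pred Carrier ℓ
      respect : member Respects _≈_
  open Subset

  _∈_ _∉_ : Carrier → Subset → Set ℓ
  x ∈ X = member X x
  x ∉ X = ¬ x ∈ X

  _⊆_ _≐_ : Rel Subset ℓ
  X ⊆ Y = ∀ {x} → x ∈ X → x ∈ Y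
  X ≐ Y = X ⊆ Y × Y ⊆ X

  ∅ : Subset
  ∅ = record { member = λ _ → ⊥ ; respect = λ _ () }

  ｛_｝ : Carrier → Subset
  ｛ x ｝ = record { member = _≈ x ; respect = λ y≈z y≈x → trans (sym y≈z) y≈x }

  _∪_ _∖_ : Subset → Subset → Subset
  X ∪ Y = record
    { member  = λ x → x ∈ X ⊎ x ∈ Y
    ; respect = λ x≈y → Sum.map (respect X x≈y) (respect Y x≈y)
    }
  X ∖ Y = record
    { member  = λ x → x ∈ X × x ∉ Y
    ; respect = λ x≈y (x∈X , x∉Y) → respect X x≈y x∈X , x∉Y ∘ respect Y (sym x≈y)
    }

  image : (Carrier → Carrier) → Subset → Subset
  image f X = record
    { member  = λ y → ∃[ x ] (x ∈ X × y ≈ f x)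
    ; respect = λ y≈z (x , x∈X , y≈fx) → x , x∈X , trans (sym y≈z) y≈fx
    }

  fromList : List Carrier → Subset
  fromList xs = record { member = ListE._∈ xs ; respect = ∈-resp-≈ E }

module OrientedMatroids {ℓ} (E : Setoid ℓ ℓ)
                        (_* : Setoid.Carrier E → Setoid.Carrier E) where
  open Setoid E
  open Subsets E public
  open AlgebraDefinitions _≈_ using (Involutive; Congruent₁)

  _⋆ : Subset → Subset
  _⋆ = image _*

  record IsClosureOperator (cx : Subset → Subset) : Set (lsuc ℓ) where
    field
      extensive  : ∀ X → X ⊆ cx X
      monotone   : ∀ {X Y} → X ⊆ Y → cx X ⊆ cx Y
      idempotent : ∀ X → cx (cx X) ≐ cx X

  record IsOrientedMatroid (cx : Subset → Subset) : Set (lsuc ℓ) where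
    field
      *-cong            : Congruent₁ _*
      *-involutive      : Involutive _*
      *-fixedPointFree  : ∀ x → ¬ (x * ≈ x)
      isClosureOperator : IsClosureOperator cx
      cx-* : ∀ X → (cx X) ⋆ ≐ cx (X ⋆)
      cx-cancel : ∀ X x → x ∈ cx (X ∪ ｛ x * ｝) → x ∈ cx X
      cx-exchange : ∀ X x y → x ∈ cx (X ∪ ｛ y * ｝) → x ∉ cx X →
                    y ∈ cx ((X ∖ ｛ y ｝) ∪ ｛ x * ｝)
      cx-finitary : ∀ X x → x ∈ cx X →
                    ∃[ ys ] (All (_∈ X) ys × x ∈ cx (fromList ys))

  record IsReduced (cx : Subset → Subset) : Set ℓ where
    field
      cx-∅         : cx ∅ ≐ ∅
      cx-singleton : ∀ x → cx ｛ x ｝ ≐ ｛ x ｝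

  Asymmetric : Subset → Set ℓ
  Asymmetric X = ∀ x → ¬ (x ∈ X × x ∈ X ⋆)

  AsymmetricClosed : (Subset → Subset) → Subset → Set ℓ
  AsymmetricClosed cx X = Asymmetric X × cx X ≐ X

  IsTope : (Subset → Subset) → Subset → Set (lsuc ℓ)
  IsTope cx X = AsymmetricClosed cx X
              × (∀ Y → AsymmetricClosed cx Y → X ⊆ Y → Y ⊆ X)

  Topal : Subset → Set ℓ
  Topal R = ∀ x → (x ∈ R × x * ∉ R) ⊎ (x ∉ R × x * ∈ R)

module Roots {ℓ} {ℝ : RealNumbers ℓ} (Φ : RootSystem ℝ) where
  open RealNumbers ℝ
  open RootSystem Φ
  open OrderedFieldProperties ℝ
  open LeftModuleProperties V using (inverseʳ-uniqueᴹ)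

  -- Elements of W are represented by words in the simple reflections; these
  -- are involutions, so inverses are not needed.
  W : Set
  W = List (Fin rank)

  act : W → Carrierᴹ → Carrierᴹ
  act []      v = v
  act (i ∷ w) v = reflect (simple i) (act w v)

  private module ⟨V⟩ = SetoidReasoning ≈ᴹ-setoid
  private module ⟨R⟩ = SetoidReasoning setoid

  act-cong : ∀ w {u v} → u ≈ᴹ v → act w u ≈ᴹ act w v
  act-cong []      u≈v = u≈v
  act-cong (i ∷ w) u≈v =
    +ᴹ-cong eq (-ᴹ‿cong (*ₗ-congʳ (*-congʳ (*-congˡ (⟨⟩-cong eq ≈ᴹ-refl)))))
    where eq = act-cong w u≈v

  act-++ : ∀ w w′ v → act (w ++ w′) v ≈ᴹ act w (act w′ v)
  act-++ []      w′ v = ≈ᴹ-refl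
  act-++ (i ∷ w) w′ v = act-cong [ i ] (act-++ w w′ v)

  neg≈-1 : ∀ v → -ᴹ v ≈ᴹ (- 1#) *ₗ v
  neg≈-1 v = ≈ᴹ-sym (inverseʳ-uniqueᴹ v ((- 1#) *ₗ v) (⟨V⟩.begin
    v +ᴹ (- 1#) *ₗ v          ⟨V⟩.≈⟨ +ᴹ-congʳ (*ₗ-identityˡ v) ⟨
    1# *ₗ v +ᴹ (- 1#) *ₗ v    ⟨V⟩.≈⟨ *ₗ-distribʳ v 1# (- 1#) ⟨
    (1# + - 1#) *ₗ v          ⟨V⟩.≈⟨ *ₗ-congʳ (-‿inverseʳ 1#) ⟩
    0# *ₗ v                   ⟨V⟩.≈⟨ *ₗ-zeroˡ v ⟩
    0ᴹ                        ⟨V⟩.∎))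

  *ₗ-comm : ∀ a b v → a *ₗ (b *ₗ v) ≈ᴹ b *ₗ (a *ₗ v)
  *ₗ-comm a b v = ≈ᴹ-trans (≈ᴹ-sym (*ₗ-assoc a b v))
    (≈ᴹ-trans (*ₗ-congʳ (*-comm a b)) (*ₗ-assoc b a v))

  -ᴹ-*ₗ : ∀ c v → -ᴹ (c *ₗ v) ≈ᴹ c *ₗ -ᴹ v
  -ᴹ-*ₗ c v = ≈ᴹ-trans (neg≈-1 _) (≈ᴹ-trans (*ₗ-comm (- 1#) c v) (*ₗ-congˡ (≈ᴹ-sym (neg≈-1 v))))

  reflect-scale : ∀ α c v → reflect α (c *ₗ v) ≈ᴹ c *ₗ reflect α v
  reflect-scale α c v = ⟨V⟩.begin
    c *ₗ v +ᴹ -ᴹ ((2# * ⟨ c *ₗ v ∣ α ⟩ * n) *ₗ α)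
      ⟨V⟩.≈⟨ +ᴹ-congˡ (-ᴹ‿cong (*ₗ-congʳ coeff)) ⟩
    c *ₗ v +ᴹ -ᴹ ((c * (2# * ⟨ v ∣ α ⟩ * n)) *ₗ α)
      ⟨V⟩.≈⟨ +ᴹ-congˡ (-ᴹ‿cong (*ₗ-assoc c _ α)) ⟩
    c *ₗ v +ᴹ -ᴹ (c *ₗ ((2# * ⟨ v ∣ α ⟩ * n) *ₗ α))
      ⟨V⟩.≈⟨ +ᴹ-congˡ (-ᴹ-*ₗ c _) ⟩
    c *ₗ v +ᴹ c *ₗ -ᴹ ((2# * ⟨ v ∣ α ⟩ * n) *ₗ α)
      ⟨V⟩.≈⟨ *ₗ-distribˡ c v _ ⟨
    c *ₗ reflect α v ⟨V⟩.∎
    where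
    2# = 1# + 1#
    n = ⟨ α ∣ α ⟩ ⁻¹
    coeff : 2# * ⟨ c *ₗ v ∣ α ⟩ * n ≈ c * (2# * ⟨ v ∣ α ⟩ * n)
    coeff = ⟨R⟩.begin
      2# * ⟨ c *ₗ v ∣ α ⟩ * n    ⟨R⟩.≈⟨ *-congʳ (*-congˡ (⟨⟩-*ˡ c v α)) ⟩
      2# * (c * ⟨ v ∣ α ⟩) * n   ⟨R⟩.≈⟨ *-congʳ (*-assoc 2# c _) ⟨
      2# * c * ⟨ v ∣ α ⟩ * n     ⟨R⟩.≈⟨ *-congʳ (*-congʳ (*-comm 2# c)) ⟩
      c * 2# * ⟨ v ∣ α ⟩ * n     ⟨R⟩.≈⟨ *-congʳ (*-assoc c 2# _) ⟩
      c * (2# * ⟨ v ∣ α ⟩) * n   ⟨R⟩.≈⟨ *-assoc c _ n ⟩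
      c * (2# * ⟨ v ∣ α ⟩ * n)   ⟨R⟩.∎

  act-scale : ∀ w c v → act w (c *ₗ v) ≈ᴹ c *ₗ act w v
  act-scale []      c v = ≈ᴹ-refl
  act-scale (i ∷ w) c v = ≈ᴹ-trans (act-cong [ i ] (act-scale w c v))
    (reflect-scale (simple i) c (act w v))

  act-neg : ∀ w v → act w (-ᴹ v) ≈ᴹ -ᴹ act w v
  act-neg w v = ≈ᴹ-trans (act-cong w (neg≈-1 v))
    (≈ᴹ-trans (act-scale w (- 1#) v) (≈ᴹ-sym (neg≈-1 _)))

  reflect-simple : ∀ i → reflect (simple i) (simple i) ≈ᴹ -ᴹ simple i
  reflect-simple i = ⟨V⟩.begin
    α +ᴹ -ᴹ ((2# * ⟨ α ∣ α ⟩ * ⟨ α ∣ α ⟩ ⁻¹) *ₗ α)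
      ⟨V⟩.≈⟨ +ᴹ-congˡ (-ᴹ‿cong (*ₗ-congʳ coeff)) ⟩
    α +ᴹ -ᴹ (2# *ₗ α)
      ⟨V⟩.≈⟨ +ᴹ-cong (≈ᴹ-sym (*ₗ-identityˡ α)) (neg≈-1 _) ⟩
    1# *ₗ α +ᴹ (- 1#) *ₗ (2# *ₗ α)
      ⟨V⟩.≈⟨ +ᴹ-congˡ (*ₗ-assoc (- 1#) 2# α) ⟨
    1# *ₗ α +ᴹ (- 1# * 2#) *ₗ α
      ⟨V⟩.≈⟨ *ₗ-distribʳ α 1# (- 1# * 2#) ⟨
    (1# + - 1# * 2#) *ₗ α
      ⟨V⟩.≈⟨ *ₗ-congʳ 1-2 ⟩
    (- 1#) *ₗ α
      ⟨V⟩.≈⟨ neg≈-1 α ⟨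
    -ᴹ α ⟨V⟩.∎
    where
    α = simple i
    2# = 1# + 1#
    coeff : 2# * ⟨ α ∣ α ⟩ * ⟨ α ∣ α ⟩ ⁻¹ ≈ 2#
    coeff = trans (*-assoc 2# _ _)
      (trans (*-congˡ (⁻¹-inverseʳ _ (proj₂ (simple-pos i) ∘ sym))) (*-identityʳ 2#))
    1-2 : 1# + - 1# * 2# ≈ - 1#
    1-2 = ⟨R⟩.begin
      1# + - 1# * 2#               ⟨R⟩.≈⟨ +-congˡ (distribˡ (- 1#) 1# 1#) ⟩
      1# + (- 1# * 1# + - 1# * 1#) ⟨R⟩.≈⟨ +-congˡ (+-cong (*-identityʳ _) (*-identityʳ _)) ⟩
      1# + (- 1# + - 1#)           ⟨R⟩.≈⟨ +-assoc 1# (- 1#) (- 1#) ⟨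
      1# + - 1# + - 1#             ⟨R⟩.≈⟨ +-congʳ (-‿inverseʳ 1#) ⟩
      0# + - 1#                    ⟨R⟩.≈⟨ +-identityˡ (- 1#) ⟩
      - 1#                         ⟨R⟩.∎

  IsRoot : Pred Carrierᴹ ℓ
  IsRoot v = ∃[ w ] ∃[ i ] (v ≈ᴹ act w (simple i))

  record Root : Set ℓ where
    constructor root
    field
      vector : Carrierᴹ
      isRoot : IsRoot vector
  open Root public

  _∙_ : W → Root → Root
  w ∙ root v (w′ , i , v≈) = root (act w v)
    (w ++ w′ , i , ≈ᴹ-trans (act-cong w v≈) (≈ᴹ-sym (act-++ w w′ (simple i))))

  -- If v = w α then - v = w s_α α.
  neg : Root → Root
  neg (root v (w , i , v≈)) = root (-ᴹ v) (w ++ [ i ] , i , (⟨V⟩.begin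
    -ᴹ v                            ⟨V⟩.≈⟨ -ᴹ‿cong v≈ ⟩
    -ᴹ act w (simple i)             ⟨V⟩.≈⟨ act-neg w (simple i) ⟨
    act w (-ᴹ simple i)             ⟨V⟩.≈⟨ act-cong w (reflect-simple i) ⟨
    act w (act [ i ] (simple i))    ⟨V⟩.≈⟨ act-++ w [ i ] (simple i) ⟨
    act (w ++ [ i ]) (simple i)     ⟨V⟩.∎))

  infix 4 _∼_
  _∼_ : Rel Root ℓ
  α ∼ β = ∃[ c ] (0# < c × vector α ≈ᴹ c *ₗ vector β)

  ∼-refl : Reflexive _∼_
  ∼-refl = 1# , 0<1 , ≈ᴹ-sym (*ₗ-identityˡ _)

  ∼-sym : Symmetric _∼_
  ∼-sym {α} {β} (c , 0<c , α≈cβ) = c ⁻¹ , ⁻¹-pos 0<c , ≈ᴹ-sym (⟨V⟩.begin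
    c ⁻¹ *ₗ vector α           ⟨V⟩.≈⟨ *ₗ-congˡ α≈cβ ⟩
    c ⁻¹ *ₗ (c *ₗ vector β)    ⟨V⟩.≈⟨ *ₗ-assoc (c ⁻¹) c _ ⟨
    (c ⁻¹ * c) *ₗ vector β     ⟨V⟩.≈⟨ *ₗ-congʳ (*-comm (c ⁻¹) c) ⟩
    (c * c ⁻¹) *ₗ vector β     ⟨V⟩.≈⟨ *ₗ-congʳ (⁻¹-inverseʳ c (proj₂ 0<c ∘ sym)) ⟩
    1# *ₗ vector β             ⟨V⟩.≈⟨ *ₗ-identityˡ _ ⟩
    vector β                   ⟨V⟩.∎)

  ∼-trans : Transitive _∼_
  ∼-trans (c , 0<c , α≈cβ) (d , 0<d , β≈dγ) = c * d , *-pos 0<c 0<d ,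
    ≈ᴹ-trans α≈cβ (≈ᴹ-trans (*ₗ-congˡ β≈dγ) (≈ᴹ-sym (*ₗ-assoc c d _)))

  -- The set of rays: roots up to positive scalar multiples.
  Φ̄ : Setoid ℓ ℓ
  Φ̄ = record
    { Carrier = Root
    ; _≈_ = _∼_
    ; isEquivalence = record
      { refl  = λ {α} → ∼-refl {α}
      ; sym   = λ {α} {β} → ∼-sym {α} {β}
      ; trans = λ {α} {β} {γ} → ∼-trans {α} {β} {γ}
      }
    }

  open OrientedMatroids Φ̄ neg public

  vectors : Subset → Pred Carrierᴹ ℓ
  vectors X v = ∃[ α ] (α ∈ X × v ≈ᴹ vector α)

  Positive : Pred Root ℓ
  Positive α = cone (range simple) (vector α)

  rays : Pred Root ℓ → Subset
  rays P = record
    { member  = λ α → ∃[ β ] (P β × α ∼ β)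
    ; respect = λ {α} {α′} α∼α′ (β , Pβ , α∼β) →
        β , Pβ , ∼-trans {α′} {α} {β} (∼-sym {α} {α′} α∼α′) α∼β
    }

  Φ̄⁺ : Subset
  Φ̄⁺ = rays Positive

  coneΦ : Subset → Subset
  coneΦ X = rays (λ α → cone (vectors X) (vector α))

  record IsOMRS (d : Subset → Subset) : Set (lsuc ℓ) where
    field
      isOrientedMatroid : IsOrientedMatroid d
      isReduced         : IsReduced d
      equivariant : ∀ w X → d (image (w ∙_) X) ≐ image (w ∙_) (d X)
      positive    : d Φ̄⁺ ≐ Φ̄⁺
      planar      : ∀ X → (∃[ k ] (k ℕ.≤ 2 × HasDimension (span (vectors X)) k)) →
                    d X ≐ coneΦ X

  C₂Closed : Pred Root ℓ → Set ℓ
  C₂Closed B = ∀ α β γ → B α → B β → Positive γ →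
    (∃[ a ] ∃[ b ] (0# ≤ a × 0# ≤ b
                   × vector γ ≈ᴹ a *ₗ vector α +ᴹ b *ₗ vector β)) →
    B γ

  C₂Biclosed : Pred Root ℓ → Set ℓ
  C₂Biclosed B = C₂Closed B × C₂Closed (λ α → Positive α × ¬ B α)

  IsQuasitope : Subset → Set ℓ
  IsQuasitope R = Topal R × C₂Biclosed (λ α → Positive α × α ∈ R)

  Clean : Set (lsuc ℓ)
  Clean = ∀ R → IsQuasitope R → IsTope coneΦ R

-- The conic closure coneΦ is always an oriented matroid root system.  Conversely let d be one.
--
-- coneΦ ⊆ d: by Carathéodory's theorem it is enough to treat the cone of linearly independent roots,
-- of which there are at most three.  Their d-closure contains no antipodal pair, since d agrees with
-- coneΦ on all but one of them.  If some x in the cone were missing from the d-closure, then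
-- adjoining x * would keep it asymmetric, and it would extend to a topal d-closed set T.  As d and
-- coneΦ agree in rank two, T is a quasitope, hence by cleanness a tope of coneΦ, hence contains x.
--
-- d ⊆ coneΦ: for a symmetric set of roots either d and coneΦ agree because the set spans at most
-- a plane, or its cone contains every root.  The general case follows by induction on the number of
-- points, trading one point at a time for an antipodal pair.

module Submission where

open import Defs
open import Algebra.Bundles using (CommutativeMonoid)
open import Algebra.Module.Bundles using (LeftModule)
import Algebra.Properties.AbelianGroup as AbelianGroupProperties
import Algebra.Properties.CommutativeMonoid.Sum as Summation
import Algebra.Properties.CommutativeSemigroup as CommutativeSemigroupProperties
import Algebra.Properties.Ring as RingProperties
open import Axiom.ExcludedMiddle using (ExcludedMiddle)
open import Data.Fin.Base using (Fin; zero; suc; punchIn)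
open import Data.List.Base as List using (List; []; _∷_; [_]; allFin; cartesianProductWith; length)
import Data.List.Membership.Propositional as Propositional
open import Data.List.Membership.Propositional.Properties using (∈-cartesianProductWith⁺; ∈-allFin)
import Data.List.Membership.Setoid as ListMembership
open import Data.List.Relation.Unary.All using (All; []; _∷_)
open import Data.List.Relation.Unary.Any as Any using (here; there)
open import Data.Nat.Base as ℕ using (ℕ; zero; suc)
import Data.Nat.Properties as ℕ
open import Data.Product using (∃; ∃!; Σ; ∃-syntax; _×_; _,_; proj₁; proj₂)
open import Data.Sum.Base using (_⊎_; inj₁; inj₂; map₁)
open import Data.Unit.Polymorphic using (⊤; tt)
open import Data.Vec.Functional as Vector using (tail; insertAt; removeAt)
open import Data.Vec.Functional.Properties using (insertAt-lookup; insertAt-punchIn)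
open import Function.Base using (_∘_; id)
open import Relation.Binary.Bundles using (Setoid)
open import Relation.Binary.PropositionalEquality using (_≡_)
import Relation.Binary.PropositionalEquality.Core as ≡
import Relation.Binary.Reasoning.Setoid as SetoidReasoning
open import Relation.Binary.Structures using (IsTotalOrder)
open import Relation.Nullary using (¬_; yes; no; contradiction)
open import Relation.Nullary.Decidable using (decidable-stable)
open import Relation.Unary using (Pred)

-- General facts about oriented matroids.

module OrientedMatroidProperties {ℓ} (em : ∀ {a} → ExcludedMiddle a) (E : Setoid ℓ ℓ)
                                 (_* : Setoid.Carrier E → Setoid.Carrier E) where
  open Setoid E
  open OrientedMatroids E _*
  open Subset
  open ListMembership E using () renaming (_∈_ to _∈ˡ_)

  ∪-mono : ∀ {X Y Z} → X ⊆ Y → X ∪ Z ⊆ Y ∪ Z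
  ∪-mono X⊆Y = map₁ X⊆Y

  -- Built one point at a time, so that an induction on the list can treat its points separately
  -- from the base set.
  adjoin : Subset → List Carrier → Subset
  adjoin X []       = X
  adjoin X (a ∷ as) = adjoin X as ∪ ｛ a ｝

  adjoin-mono : ∀ {X Y} → X ⊆ Y → ∀ as → adjoin X as ⊆ adjoin Y as
  adjoin-mono X⊆Y []                 = X⊆Y
  adjoin-mono {X} {Y} X⊆Y (a ∷ as) =
    ∪-mono {adjoin X as} {adjoin Y as} {｛ a ｝} (adjoin-mono {X} {Y} X⊆Y as)

  adjoin-⊇ : ∀ X as → X ⊆ adjoin X as
  adjoin-⊇ X []       = id
  adjoin-⊇ X (a ∷ as) = inj₁ ∘ adjoin-⊇ X as

  fromList⊆adjoin : ∀ X as → fromList as ⊆ adjoin X as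
  fromList⊆adjoin X (a ∷ as) (here x≈a)   = inj₂ x≈a
  fromList⊆adjoin X (a ∷ as) (there x∈as) = inj₁ (fromList⊆adjoin X as x∈as)

  adjoin-∅⊆ : ∀ {X as} → All (_∈ X) as → adjoin ∅ as ⊆ X
  adjoin-∅⊆ {X} (a∈X ∷ as∈X) (inj₁ x∈)  = adjoin-∅⊆ {X} as∈X x∈
  adjoin-∅⊆ {X} (a∈X ∷ as∈X) (inj₂ x≈a) = respect X (sym x≈a) a∈X

  ±_ : Carrier → Subset
  ± a = ｛ a ｝ ∪ ｛ a * ｝

  -- Consequences of the cancellation and exchange axioms.

  module ClosureProperties {cx} (isOM : IsOrientedMatroid cx) where
    open IsOrientedMatroid isOM
    open IsClosureOperator isClosureOperator

    closure-bind : ∀ {X Y} → X ⊆ cx Y → cx X ⊆ cx Y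
    closure-bind {X} {Y} X⊆ x∈ = proj₁ (idempotent Y) (monotone {X} {cx Y} X⊆ x∈)

    point-bind : ∀ {X Y a} → X ⊆ Y → a ∈ cx Y → cx (X ∪ ｛ a ｝) ⊆ cx Y
    point-bind {X} {Y} {a} X⊆Y a∈ = closure-bind {X ∪ ｛ a ｝} {Y} λ
      { (inj₁ x∈X) → extensive Y (X⊆Y x∈X)
      ; (inj₂ x≈a) → respect (cx Y) (sym x≈a) a∈ }

    ∪-monoʳ : ∀ {X a b} → b ≈ a → cx (X ∪ ｛ a ｝) ⊆ cx (X ∪ ｛ b ｝)
    ∪-monoʳ {X} {a} {b} b≈a = monotone {X ∪ ｛ a ｝} {X ∪ ｛ b ｝} λ
      { (inj₁ x∈X) → inj₁ x∈X ; (inj₂ x≈a) → inj₂ (trans x≈a (sym b≈a)) }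

    exchange : ∀ {X x y} → x ∈ cx (X ∪ ｛ y * ｝) → x ∉ cx X → y ∈ cx (X ∪ ｛ x * ｝)
    exchange {X} {x} {y} x∈ x∉ =
      monotone {(X ∖ ｛ y ｝) ∪ ｛ x * ｝} {X ∪ ｛ x * ｝} (map₁ proj₁) (cx-exchange X x y x∈ x∉)

    -- The exchange axiom is applied over `X ∪ ｛ y ｝`: the deletion of `y` in its conclusion undoes
    -- the added point, so that only points of `X` and `x *` remain.
    exchange′ : ∀ {X x y} → x ∈ cx (X ∪ ± y) → x ∉ cx (X ∪ ｛ y ｝) → y ∈ cx (X ∪ ｛ x * ｝)
    exchange′ {X} {x} {y} x∈ x∉ =
      monotone {((X ∪ ｛ y ｝) ∖ ｛ y ｝) ∪ ｛ x * ｝} {X ∪ ｛ x * ｝}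
        (λ { (inj₁ (inj₁ z∈X , z≉y)) → inj₁ z∈X
           ; (inj₁ (inj₂ z≈y , z≉y)) → contradiction z≈y z≉y
           ; (inj₂ z≈x*) → inj₂ z≈x* })
        (cx-exchange (X ∪ ｛ y ｝) x y
          (monotone {X ∪ ± y} {X ∪ ｛ y ｝ ∪ ｛ y * ｝}
            (λ { (inj₁ z∈X) → inj₁ (inj₁ z∈X)
               ; (inj₂ (inj₁ z≈y)) → inj₁ (inj₂ z≈y)
               ; (inj₂ (inj₂ z≈y*)) → inj₂ z≈y* }) x∈) x∉)

    -- If `x` were not in `cx X`, exchange in the second hypothesis would put `a` into the closure
    -- of `X ∪ ｛ x * ｝`. By the first hypothesis `x` would lie there too, and cancelling `x *`
    -- returns `x` to `cx X`.
    ±-eliminate : ∀ {X x a} → x ∈ cx (X ∪ ｛ a ｝) → x ∈ cx (X ∪ ｛ a * ｝) → x ∈ cx X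
    ±-eliminate {X} {x} {a} x∈₊ x∈₋ with em {P = x ∈ cx X}
    ... | yes x∈X = x∈X
    ... | no  x∉X = cx-cancel X x
      (point-bind {X} {X ∪ ｛ x * ｝} inj₁ (exchange {X} x∈₋ x∉X) x∈₊)

    -- If both alternatives fail, `exchange′` puts `a` and `a *` into the closure of `X ∪ ｛ x * ｝`.
    -- Then `x` lies there as well, so `x ∈ cx X` by cancellation, and monotonicity gives a
    -- contradiction.
    ±-split : ∀ {X x a} → x ∈ cx (X ∪ ± a) → x ∈ cx (X ∪ ｛ a ｝) ⊎ x ∈ cx (X ∪ ｛ a * ｝)
    ±-split {X} {x} {a} x∈ with em {P = x ∈ cx (X ∪ ｛ a ｝)} | em {P = x ∈ cx (X ∪ ｛ a * ｝)}
    ... | yes x∈₊ | _       = inj₁ x∈₊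
    ... | _       | yes x∈₋ = inj₂ x∈₋
    ... | no x∉₊  | no x∉₋  = contradiction
      (monotone {X} {X ∪ ｛ a ｝} inj₁ (cx-cancel X x (closure-bind {X ∪ ± a} {X ∪ ｛ x * ｝} (λ
        { (inj₁ z∈X) → extensive (X ∪ ｛ x * ｝) (inj₁ z∈X)
        ; (inj₂ (inj₁ z≈a)) → respect (cx (X ∪ ｛ x * ｝)) (sym z≈a) a∈
        ; (inj₂ (inj₂ z≈a*)) → respect (cx (X ∪ ｛ x * ｝)) (sym z≈a*) a*∈ }) x∈)))
      x∉₊
      where
      a∈ : a ∈ cx (X ∪ ｛ x * ｝)
      a∈ = exchange′ {X} x∈ x∉₊
      a*∈ : a * ∈ cx (X ∪ ｛ x * ｝)
      a*∈ = exchange′ {X} (monotone {X ∪ ± a} {X ∪ ± (a *)} (λ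
        { (inj₁ z∈X) → inj₁ z∈X
        ; (inj₂ (inj₁ z≈a)) → inj₂ (inj₂ (trans z≈a (sym (*-involutive a))))
        ; (inj₂ (inj₂ z≈a*)) → inj₂ (inj₁ z≈a*) }) x∈) x∉₋

    ∈⋆⇒*∈ : ∀ X {x} → x ∈ X ⋆ → x * ∈ X
    ∈⋆⇒*∈ X (y , y∈X , x≈y*) = respect X (sym (trans (*-cong x≈y*) (*-involutive y))) y∈X

    *∈⇒∈⋆ : ∀ X {x} → x * ∈ X → x ∈ X ⋆
    *∈⇒∈⋆ X {x} x*∈X = x * , x*∈X , sym (*-involutive x)

    asymmetric-mono : ∀ {X Y} → X ⊆ Y → Asymmetric Y → Asymmetric X
    asymmetric-mono {X} {Y} X⊆Y asym x (x∈X , x∈X⋆) =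
      asym x (X⊆Y x∈X , *∈⇒∈⋆ Y (X⊆Y (∈⋆⇒*∈ X x∈X⋆)))

    -- Exchanging `z` with `x` gives `x` in the closure of `X ∪ ｛ z * ｝`. Since `z *` is itself
    -- generated by `X` and `x *`, so is `x`, and `x *` cancels.
    ∈-forced : ∀ {X x z} → z ∈ cx (X ∪ ｛ x * ｝) → z * ∈ cx (X ∪ ｛ x * ｝) → z ∉ cx X → x ∈ cx X
    ∈-forced {X} {x} z∈ z*∈ z∉X =
      cx-cancel X x (point-bind {X} {X ∪ ｛ x * ｝} inj₁ z*∈ (exchange {X} z∈ z∉X))

    -- Of an antipodal pair in the larger closure at least one member is outside `cx X`, because
    -- `cx X` is asymmetric. Either case of `∈-forced` then puts `x` into `cx X`.
    asymmetric-adjoin : ∀ {X x} → Asymmetric (cx X) → x ∉ cx X → Asymmetric (cx (X ∪ ｛ x * ｝))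
    asymmetric-adjoin {X} {x} asym x∉X z (z∈ , z∈⋆) with em {P = z ∈ cx X}
    ... | no  z∉X = x∉X (∈-forced z∈ (∈⋆⇒*∈ (cx (X ∪ ｛ x * ｝)) z∈⋆) z∉X)
    ... | yes z∈X = x∉X (∈-forced (∈⋆⇒*∈ (cx (X ∪ ｛ x * ｝)) z∈⋆)
      (respect (cx (X ∪ ｛ x * ｝)) (sym (*-involutive z)) z∈)
      (λ z*∈X → asym z (z∈X , *∈⇒∈⋆ (cx X) z*∈X)))

    -- Extending a closed asymmetric set to a closed topal set.

    module _ (stage : ℕ → List Carrier) (covers : ∀ x → ∃[ n ] (x ∈ˡ stage n)) where

      -- Countability replaces Zorn's lemma.
      step : Subset → Carrier → Subset
      step X a with em {P = a * ∈ X}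
      ... | yes _ = X
      ... | no  _ = cx (X ∪ ｛ a ｝)

      step-⊇ : ∀ X a → X ⊆ step X a
      step-⊇ X a x∈X with em {P = a * ∈ X}
      ... | yes _ = x∈X
      ... | no  _ = extensive (X ∪ ｛ a ｝) (inj₁ x∈X)

      step-decides : ∀ X a → a ∈ step X a ⊎ a * ∈ step X a
      step-decides X a with em {P = a * ∈ X}
      ... | yes a*∈X = inj₂ a*∈X
      ... | no  _    = inj₁ (extensive (X ∪ ｛ a ｝) (inj₂ refl))

      step-closed : ∀ X a → AsymmetricClosed cx X → AsymmetricClosed cx (step X a)
      step-closed X a (asym , closed) with em {P = a * ∈ X}
      ... | yes _    = asym , closed
      ... | no  a*∉X =
        -- The missing point to which `asymmetric-adjoin` is applied is `a *`. Its opposite `a * *`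
        -- is what gets adjoined, and this is equivalent to `a`.
        asymmetric-mono {cx (X ∪ ｛ a ｝)} {cx (X ∪ ｛ a * * ｝)} (∪-monoʳ {X} (*-involutive a))
          (asymmetric-adjoin {X} (asymmetric-mono {cx X} {X} (proj₁ closed) asym)
            (a*∉X ∘ proj₁ closed))
        , idempotent (X ∪ ｛ a ｝)

      steps : Subset → List Carrier → Subset
      steps X []       = X
      steps X (a ∷ as) = steps (step X a) as

      steps-⊇ : ∀ X as → X ⊆ steps X as
      steps-⊇ X []       x∈X = x∈X
      steps-⊇ X (a ∷ as) x∈X = steps-⊇ (step X a) as (step-⊇ X a x∈X)

      steps-decides : ∀ X as {x} → x ∈ˡ as → x ∈ steps X as ⊎ x * ∈ steps X as
      steps-decides X (a ∷ as) (there x∈as) = steps-decides (step X a) as x∈as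
      steps-decides X (a ∷ as) (here x≈a) with step-decides X a
      ... | inj₁ a∈  = inj₁ (respect (steps X (a ∷ as)) (sym x≈a)
                         (steps-⊇ (step X a) as a∈))
      ... | inj₂ a*∈ = inj₂ (respect (steps X (a ∷ as)) (*-cong (sym x≈a))
                         (steps-⊇ (step X a) as a*∈))

      steps-closed : ∀ X as → AsymmetricClosed cx X → AsymmetricClosed cx (steps X as)
      steps-closed X []       ac = ac
      steps-closed X (a ∷ as) ac = steps-closed (step X a) as (step-closed X a ac)

      tower : Subset → ℕ → Subset
      tower X zero    = X
      tower X (suc n) = steps (tower X n) (stage n)

      tower-mono : ∀ X {m n} → m ℕ.≤′ n → tower X m ⊆ tower X n
      tower-mono X (ℕ.≤′-reflexive ≡.refl) x∈ = x∈
      tower-mono X (ℕ.≤′-step {n} m≤n) x∈ =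
        steps-⊇ (tower X n) (stage n) (tower-mono X m≤n x∈)

      tower-closed : ∀ X n → AsymmetricClosed cx X → AsymmetricClosed cx (tower X n)
      tower-closed X zero    ac = ac
      tower-closed X (suc n) ac = steps-closed (tower X n) (stage n) (tower-closed X n ac)

      limit : Subset → Subset
      limit X = record
        { member  = λ x → ∃[ n ] (x ∈ tower X n)
        ; respect = λ x≈y (n , x∈) → n , respect (tower X n) x≈y x∈
        }

      tower-common : ∀ X {m n x y} → x ∈ tower X m → y ∈ tower X n →
                     ∃[ k ] (x ∈ tower X k × y ∈ tower X k)
      tower-common X {m} {n} x∈ y∈ = m ℕ.⊔ n
        , tower-mono X (ℕ.≤⇒≤′ (ℕ.m≤m⊔n m n)) x∈
        , tower-mono X (ℕ.≤⇒≤′ (ℕ.m≤n⊔m m n)) y∈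

      fromList⊆tower : ∀ X {ys} → All (_∈ limit X) ys → ∃[ n ] (fromList ys ⊆ tower X n)
      fromList⊆tower X []                  = 0 , λ ()
      fromList⊆tower X ((m , y∈) ∷ ys∈) with fromList⊆tower X ys∈
      ... | n , ys⊆ = m ℕ.⊔ n , λ
        { (here x≈y)   → respect (tower X (m ℕ.⊔ n)) (sym x≈y)
                           (tower-mono X (ℕ.≤⇒≤′ (ℕ.m≤m⊔n m n)) y∈)
        ; (there x∈ys) → tower-mono X (ℕ.≤⇒≤′ (ℕ.m≤n⊔m m n)) (ys⊆ x∈ys) }

      -- Every point occurs in some stage, and the next level of the tower contains it or its
      -- opposite. The levels increase, so an antipodal pair in the union would already lie in one
      -- level. By finitarity a point of the closure comes from finitely many points, which also lie
      -- in a common closed level.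
      topal-extension : ∀ X → AsymmetricClosed cx X →
                        ∃[ T ] (X ⊆ T × AsymmetricClosed cx T × Topal T)
      topal-extension X ac = limit X , (0 ,_) , (asym , closed , extensive (limit X)) , topal
        where
        ¬both : ∀ {x} → x ∈ limit X → x * ∉ limit X
        ¬both {x} (m , x∈) (n , x*∈) with tower-common X {m} {n} x∈ x*∈
        ... | k , x∈ₖ , x*∈ₖ =
          proj₁ (tower-closed X k ac) x (x∈ₖ , *∈⇒∈⋆ (tower X k) x*∈ₖ)
        asym : Asymmetric (limit X)
        asym x (x∈ , x∈⋆) = ¬both x∈ (∈⋆⇒*∈ (limit X) x∈⋆)
        closed : cx (limit X) ⊆ limit X
        closed {x} x∈ with cx-finitary (limit X) x x∈
        ... | ys , ys∈ , x∈ys with fromList⊆tower X ys∈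
        ... | n , ys⊆ = n , proj₁ (proj₂ (tower-closed X n ac))
                              (monotone {fromList ys} {tower X n} ys⊆ x∈ys)
        topal : Topal (limit X)
        topal x with covers x
        ... | n , x∈ with steps-decides (tower X n) (stage n) x∈
        ... | inj₁ x∈T  = inj₁ ((suc n , x∈T) , ¬both (suc n , x∈T))
        ... | inj₂ x*∈T = inj₂ ((λ x∈T → ¬both x∈T (suc n , x*∈T)) , (suc n , x*∈T))

  -- Comparison of two oriented matroids on the same set.

  module _ {cx₁ cx₂} (isOM₁ : IsOrientedMatroid cx₁) (isOM₂ : IsOrientedMatroid cx₂) where
    private
      module M₁ = IsOrientedMatroid isOM₁
      module M₂ = IsOrientedMatroid isOM₂
      module C₁ = IsClosureOperator M₁.isClosureOperator
      module C₂ = IsClosureOperator M₂.isClosureOperator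
      module P₁ = ClosureProperties isOM₁
      module P₂ = ClosureProperties isOM₂

    Symmetric : Subset → Set ℓ
    Symmetric X = ∀ {x} → x ∈ X → x * ∈ X

    -- Symmetric sets suffice: a point a adjoined to Z is first replaced by the pair ± a.  By ±-split for
    -- cx₁ a point obtained from Z ∪ ± a comes from Z ∪ a or from Z ∪ a *; in the second case ±-eliminate
    -- for cx₂ shows that Z alone already yields it.
    ⊇-from-symmetric : (∀ X → cx₁ X ⊆ cx₂ X) → (∀ X → Symmetric X → cx₂ X ⊆ cx₁ X) →
                       ∀ X → cx₂ X ⊆ cx₁ X
    ⊇-from-symmetric cx₁⊆cx₂ symmetric X {x} x∈ with M₂.cx-finitary X x x∈
    ... | ys , ys∈ , x∈ys = C₁.monotone {adjoin ∅ ys} {X} (adjoin-∅⊆ {X} ys∈)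
      (finite ys ∅ (λ ()) (C₂.monotone {fromList ys} {adjoin ∅ ys} (fromList⊆adjoin ∅ ys) x∈ys))
      where
      -- `Y` varies in the induction: it absorbs the pair `± a` while the list gets shorter, and the
      -- empty list leaves just a symmetric set.
      finite : ∀ as Y → Symmetric Y → cx₂ (adjoin Y as) ⊆ cx₁ (adjoin Y as)
      finite []       Y Y-sym     = symmetric Y Y-sym
      finite (a ∷ as) Y Y-sym {x} x∈ with P₁.±-split {Z} {x} {a} x∈±
        where
        Z = adjoin Y as
        Y± = Y ∪ ± a
        Y±-sym : Symmetric Y±
        Y±-sym (inj₁ x∈Y)         = inj₁ (Y-sym x∈Y)
        Y±-sym (inj₂ (inj₁ x≈a))  = inj₂ (inj₂ (M₁.*-cong x≈a))
        Y±-sym (inj₂ (inj₂ x≈a*)) =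
          inj₂ (inj₁ (trans (M₁.*-cong x≈a*) (M₁.*-involutive a)))
        x∈± : x ∈ cx₁ (Z ∪ ± a)
        x∈± = C₁.monotone {adjoin Y± as} {Z ∪ ± a} (shift as)
          (finite as Y± Y±-sym (C₂.monotone {Z ∪ ｛ a ｝} {adjoin Y± as} (λ
            { (inj₁ z∈Z) → adjoin-mono {Y} {Y±} inj₁ as z∈Z
            ; (inj₂ z≈a) → adjoin-⊇ Y± as (inj₂ (inj₁ z≈a)) }) x∈))
          where
          -- Moves the pair `± a` from the base set to the outside, where `±-split` can act on it.
          shift : ∀ bs → adjoin Y± bs ⊆ adjoin Y bs ∪ ± a
          shift []       z∈                = z∈
          shift (b ∷ bs) (inj₁ z∈) with shift bs z∈
          ... | inj₁ z∈′ = inj₁ (inj₁ z∈′)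
          ... | inj₂ z∈± = inj₂ z∈±
          shift (b ∷ bs) (inj₂ z≈b)        = inj₁ (inj₂ z≈b)
      ... | inj₁ x∈₊ = x∈₊
      ... | inj₂ x∈₋ = C₁.monotone {adjoin Y as} {adjoin Y as ∪ ｛ a ｝} inj₁
        (finite as Y Y-sym (P₂.±-eliminate {adjoin Y as} x∈ (cx₁⊆cx₂ (adjoin Y as ∪ ｛ a * ｝) x∈₋)))

-- Linear algebra over the reals.

module LinearAlgebra {ℓ} (em : ∀ {a} → ExcludedMiddle a) (ℝ : RealNumbers ℓ)
                     (V : LeftModule (RealNumbers.ring ℝ) ℓ ℓ) where
  open RealNumbers ℝ hiding (zero)
  open LeftModule V
  open VectorSpace ℝ V
  open OrderedFieldProperties ℝ
  open IsTotalOrder isTotalOrder using (total; antisym; ≤-respˡ-≈; ≤-respʳ-≈)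
    renaming (refl to ≤-refl; trans to ≤-trans; reflexive to ≤-reflexive)
  open RingProperties ring using (-‿distribˡ-*; -‿distribʳ-*; -‿involutive; -0#≈0#; -1*x≈-x)
  open AbelianGroupProperties +ᴹ-abelianGroup using ()
    renaming (inverseʳ-unique to -ᴹ-unique)
  open CommutativeSemigroupProperties
    (CommutativeMonoid.commutativeSemigroup +ᴹ-commutativeMonoid)
    using (interchange; x∙yz≈y∙xz)
  open Summation +ᴹ-commutativeMonoid using (sum-cong-≋; sum-remove; ∑-distrib-+)
  private
    module ⟨V⟩ = SetoidReasoning ≈ᴹ-setoid
    module ⟨R⟩ = SetoidReasoning setoid

  +-nonneg : ∀ {x y} → 0# ≤ x → 0# ≤ y → 0# ≤ x + y
  +-nonneg {x} {y} 0≤x 0≤y = ≤-trans 0≤y (≤-respˡ-≈ (+-identityˡ y) (+-monoˡ-≤ y 0≤x))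

  x≤y⇒0≤y-x : ∀ {x y} → x ≤ y → 0# ≤ y + - x
  x≤y⇒0≤y-x {x} x≤y = ≤-respˡ-≈ (-‿inverseʳ x) (+-monoˡ-≤ (- x) x≤y)

  0≤x⇒-x≤0 : ∀ {x} → 0# ≤ x → - x ≤ 0#
  0≤x⇒-x≤0 {x} 0≤x = ≤-respˡ-≈ (+-identityˡ (- x)) (≤-respʳ-≈ (-‿inverseʳ x) (+-monoˡ-≤ (- x) 0≤x))

  0<1+x : ∀ {x} → 0# ≤ x → 0# < 1# + x
  0<1+x {x} 0≤x = ≤-trans (proj₁ 0<1) 1≤ , λ 0≈ → 0≉1 (antisym (proj₁ 0<1) (≤-respʳ-≈ (sym 0≈) 1≤))
    where
    1≤ : 1# ≤ 1# + x
    1≤ = ≤-respˡ-≈ (+-identityˡ 1#) (≤-respʳ-≈ (+-comm x 1#) (+-monoˡ-≤ 1# 0≤x))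

  ⁻¹-inverseˡ : ∀ {x} → ¬ x ≈ 0# → x ⁻¹ * x ≈ 1#
  ⁻¹-inverseˡ {x} x≉0 = trans (*-comm (x ⁻¹) x) (⁻¹-inverseʳ x x≉0)

  neg≈-1 : ∀ v → -ᴹ v ≈ᴹ (- 1#) *ₗ v
  neg≈-1 v = ≈ᴹ-sym (-ᴹ-unique v ((- 1#) *ₗ v) (⟨V⟩.begin
    v +ᴹ (- 1#) *ₗ v          ⟨V⟩.≈⟨ +ᴹ-congʳ (*ₗ-identityˡ v) ⟨
    1# *ₗ v +ᴹ (- 1#) *ₗ v    ⟨V⟩.≈⟨ *ₗ-distribʳ v 1# (- 1#) ⟨
    (1# + - 1#) *ₗ v          ⟨V⟩.≈⟨ *ₗ-congʳ (-‿inverseʳ 1#) ⟩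
    0# *ₗ v                   ⟨V⟩.≈⟨ *ₗ-zeroˡ v ⟩
    0ᴹ                        ⟨V⟩.∎))

  cancel-scale : ∀ {c} v → ¬ c ≈ 0# → c ⁻¹ *ₗ (c *ₗ v) ≈ᴹ v
  cancel-scale {c} v c≉0 = ≈ᴹ-trans (≈ᴹ-sym (*ₗ-assoc (c ⁻¹) c v))
    (≈ᴹ-trans (*ₗ-congʳ (⁻¹-inverseˡ c≉0)) (*ₗ-identityˡ v))

  scale≈0 : ∀ {c v} → ¬ c ≈ 0# → c *ₗ v ≈ᴹ 0ᴹ → v ≈ᴹ 0ᴹ
  scale≈0 {c} {v} c≉0 cv≈0 = ≈ᴹ-trans (≈ᴹ-sym (cancel-scale v c≉0))
    (≈ᴹ-trans (*ₗ-congˡ cv≈0) (*ₗ-zeroʳ (c ⁻¹)))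

  solve-relation : ∀ {c v u} → ¬ c ≈ 0# → c *ₗ v +ᴹ u ≈ᴹ 0ᴹ → v ≈ᴹ (- 1# * c ⁻¹) *ₗ u
  solve-relation {c} {v} {u} c≉0 eq = ⟨V⟩.begin
    v                             ⟨V⟩.≈⟨ cancel-scale v c≉0 ⟨
    c ⁻¹ *ₗ (c *ₗ v)              ⟨V⟩.≈⟨ *ₗ-congˡ (-ᴹ-unique u (c *ₗ v) (≈ᴹ-trans (+ᴹ-comm u _) eq)) ⟩
    c ⁻¹ *ₗ (-ᴹ u)                ⟨V⟩.≈⟨ *ₗ-congˡ (neg≈-1 u) ⟩
    c ⁻¹ *ₗ ((- 1#) *ₗ u)         ⟨V⟩.≈⟨ *ₗ-assoc (c ⁻¹) (- 1#) u ⟨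
    (c ⁻¹ * - 1#) *ₗ u            ⟨V⟩.≈⟨ *ₗ-congʳ (*-comm (c ⁻¹) (- 1#)) ⟩
    (- 1# * c ⁻¹) *ₗ u            ⟨V⟩.∎

  combination-cong : ∀ {n} {c c′ : Fin n → Carrier} (b : Fin n → Carrierᴹ) → (∀ i → c i ≈ c′ i) →
                     combination c b ≈ᴹ combination c′ b
  combination-cong b c≈c′ = sum-cong-≋ (λ i → *ₗ-congʳ (c≈c′ i))

  combination-congʳ : ∀ {n} (c : Fin n → Carrier) {b b′ : Fin n → Carrierᴹ} → (∀ i → b i ≈ᴹ b′ i) →
                      combination c b ≈ᴹ combination c b′
  combination-congʳ c b≈b′ = sum-cong-≋ (λ i → *ₗ-congˡ (b≈b′ i))

  combination-+ : ∀ {n} (c c′ : Fin n → Carrier) (b : Fin n → Carrierᴹ) →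
                  combination (λ i → c i + c′ i) b ≈ᴹ combination c b +ᴹ combination c′ b
  combination-+ c c′ b = ≈ᴹ-trans (sum-cong-≋ (λ i → *ₗ-distribʳ (b i) (c i) (c′ i)))
    (∑-distrib-+ (λ i → c i *ₗ b i) (λ i → c′ i *ₗ b i))

  combination-* : ∀ {n} s (c : Fin n → Carrier) (b : Fin n → Carrierᴹ) →
                  combination (λ i → s * c i) b ≈ᴹ s *ₗ combination c b
  combination-* {zero}  s c b = ≈ᴹ-sym (*ₗ-zeroʳ s)
  combination-* {suc n} s c b = ≈ᴹ-trans
    (+ᴹ-cong (*ₗ-assoc s _ _) (combination-* s (tail c) (tail b)))
    (≈ᴹ-sym (*ₗ-distribˡ s _ _))

  combination-0 : ∀ {n} (b : Fin n → Carrierᴹ) → combination (λ _ → 0#) b ≈ᴹ 0ᴹ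
  combination-0 {zero}  b = ≈ᴹ-refl
  combination-0 {suc n} b = ≈ᴹ-trans (+ᴹ-cong (*ₗ-zeroˡ _) (combination-0 (tail b))) (+ᴹ-identityˡ 0ᴹ)

  -- Serves Gaussian elimination: a relation among vectors altered by multiples of a pivot `u`
  -- becomes a relation among the original vectors and `u`.
  combination-shear : ∀ {n} (r t : Fin n → Carrier) (b : Fin n → Carrierᴹ) u →
    ∃[ s ] (combination r (λ i → b i +ᴹ t i *ₗ u) ≈ᴹ s *ₗ u +ᴹ combination r b)
  combination-shear {zero}  r t b u = 0# , ≈ᴹ-sym (≈ᴹ-trans (+ᴹ-congʳ (*ₗ-zeroˡ u)) (+ᴹ-identityˡ 0ᴹ))
  combination-shear {suc n} r t b u with combination-shear (tail r) (tail t) (tail b) u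
  ... | s , eq = r zero * t zero + s , (⟨V⟩.begin
    r zero *ₗ (b zero +ᴹ t zero *ₗ u) +ᴹ _
      ⟨V⟩.≈⟨ +ᴹ-cong (≈ᴹ-trans (*ₗ-distribˡ _ _ _) (+ᴹ-comm _ _)) eq ⟩
    (r zero *ₗ (t zero *ₗ u) +ᴹ r zero *ₗ b zero) +ᴹ (s *ₗ u +ᴹ combination (tail r) (tail b))
      ⟨V⟩.≈⟨ interchange _ _ _ _ ⟩
    (r zero *ₗ (t zero *ₗ u) +ᴹ s *ₗ u) +ᴹ combination r b
      ⟨V⟩.≈⟨ +ᴹ-congʳ (+ᴹ-congʳ (*ₗ-assoc _ _ _)) ⟨
    ((r zero * t zero) *ₗ u +ᴹ s *ₗ u) +ᴹ combination r b
      ⟨V⟩.≈⟨ +ᴹ-congʳ (*ₗ-distribʳ u _ _) ⟨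
    (r zero * t zero + s) *ₗ u +ᴹ combination r b ⟨V⟩.∎)

  -- Linear independence and bases.

  Combinationᴾ : Pred Carrier ℓ → ∀ {n} → (Fin n → Carrierᴹ) → Pred Carrierᴹ ℓ
  Combinationᴾ K b v = ∃[ c ] ((∀ i → K (c i)) × v ≈ᴹ combination c b)

  SpannedBy : ∀ {n} → (Fin n → Carrierᴹ) → Pred Carrierᴹ ℓ
  SpannedBy b v = ∃[ c ] (v ≈ᴹ combination c b)

  independent-∷ : ∀ {n v} {b : Fin n → Carrierᴹ} → LinearlyIndependent b → ¬ SpannedBy b v →
                  LinearlyIndependent (v Vector.∷ b)
  independent-∷ {v = v} {b} indep v∉ c eq with em {P = c zero ≈ 0#}
  ... | no  c₀≉0 = contradiction
    ( _ , ≈ᴹ-trans (solve-relation c₀≉0 eq) (≈ᴹ-sym (combination-* _ (tail c) b))) v∉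
  ... | yes c₀≈0 = λ
    { zero    → c₀≈0
    ; (suc i) → indep (tail c) (≈ᴹ-trans (≈ᴹ-sym (≈ᴹ-trans
        (+ᴹ-congʳ (≈ᴹ-trans (*ₗ-congʳ c₀≈0) (*ₗ-zeroˡ v))) (+ᴹ-identityˡ _))) eq) i }

  independent-nonzero : ∀ {n} {b : Fin n → Carrierᴹ} → LinearlyIndependent b → ∀ i → ¬ b i ≈ᴹ 0ᴹ
  independent-nonzero {suc n} {b} indep i bᵢ≈0 =
    0≉1 (sym (≡.subst (_≈ 0#) (insertAt-lookup (λ _ → 0#) i 1#) (indep c (⟨V⟩.begin
      combination c b                       ⟨V⟩.≈⟨ sum-remove {i = i} (λ j → c j *ₗ b j) ⟩
      c i *ₗ b i +ᴹ combination (removeAt c i) (removeAt b i)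
        ⟨V⟩.≈⟨ +ᴹ-cong (≈ᴹ-trans (*ₗ-congˡ bᵢ≈0) (*ₗ-zeroʳ _))
                 (≈ᴹ-trans (combination-cong (removeAt b i)
                   (λ j → reflexive (insertAt-punchIn (λ _ → 0#) i 1# j)))
                   (combination-0 (removeAt b i))) ⟩
      0ᴹ +ᴹ 0ᴹ                              ⟨V⟩.≈⟨ +ᴹ-identityˡ 0ᴹ ⟩
      0ᴹ                                    ⟨V⟩.∎) i)))
    where
    c = insertAt (λ _ → 0#) i 1#

  -- Induction on the number of generators. If the first generator has coefficient zero in every
  -- `b i`, it is dropped. Otherwise some `b j` serves as a pivot that clears this coefficient from
  -- the other vectors; one vector and one generator disappear together.
  independent-size : ∀ {n k} {g : Fin n → Carrierᴹ} {b : Fin k → Carrierᴹ} →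
                     LinearlyIndependent b → (∀ i → SpannedBy g (b i)) → k ℕ.≤ n
  independent-size {n} {zero} _ _ = ℕ.z≤n
  independent-size {zero} {suc k} {b = b} indep b∈ =
    contradiction (proj₂ (b∈ zero)) (independent-nonzero {b = b} indep zero)
  independent-size {suc n} {suc k} {g} {b} indep b∈
    with em {P = ∃[ j ] (¬ proj₁ (b∈ j) zero ≈ 0#)}
  ... | no allZero = ℕ.m≤n⇒m≤1+n (independent-size {g = tail g} indep λ i →
    tail (proj₁ (b∈ i)) , ≈ᴹ-trans (proj₂ (b∈ i)) (≈ᴹ-trans
      (+ᴹ-congʳ (≈ᴹ-trans (*ₗ-congʳ (decidable-stable em λ c≉0 → allZero (i , c≉0))) (*ₗ-zeroˡ _)))
      (+ᴹ-identityˡ _)))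
  ... | yes (j , pivot≉0) = ℕ.s≤s (independent-size {g = tail g} {b = w} w-indep w∈)
    where
    c : ∀ i → Fin (suc n) → Carrier
    c i = proj₁ (b∈ i)
    t : Fin k → Carrier
    -- Chosen so that the coefficient of the first generator in `w i` cancels.
    t i = - (c (punchIn j i) zero * c j zero ⁻¹)
    w : Fin k → Carrierᴹ
    w i = b (punchIn j i) +ᴹ t i *ₗ b j

    w-indep : LinearlyIndependent w
    w-indep r eq i with combination-shear r t (removeAt b j) (b j)
    -- `s` is the coefficient that the pivot `b j` collects when a relation among the `w i` is
    -- expanded; inserted at `j`, it completes a relation among the `b i`.
    ... | s , shear = trans (sym (reflexive (insertAt-punchIn r j s i)))
      (indep (insertAt r j s) (⟨V⟩.begin
        combination r′ b
          ⟨V⟩.≈⟨ sum-remove {i = j} (λ i → r′ i *ₗ b i) ⟩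
        r′ j *ₗ b j +ᴹ combination (removeAt r′ j) (removeAt b j)
          ⟨V⟩.≈⟨ +ᴹ-cong (*ₗ-congʳ (reflexive (insertAt-lookup r j s)))
                   (combination-cong (removeAt b j) (λ i → reflexive (insertAt-punchIn r j s i))) ⟩
        s *ₗ b j +ᴹ combination r (removeAt b j)  ⟨V⟩.≈⟨ shear ⟨
        combination r w                           ⟨V⟩.≈⟨ eq ⟩
        0ᴹ                                        ⟨V⟩.∎) (punchIn j i))
      where r′ = insertAt r j s

    w∈ : ∀ i → SpannedBy (tail g) (w i)
    w∈ i = _ , (⟨V⟩.begin
      b (punchIn j i) +ᴹ t i *ₗ b j
        ⟨V⟩.≈⟨ +ᴹ-cong (proj₂ (b∈ (punchIn j i))) (≈ᴹ-trans (*ₗ-congˡ (proj₂ (b∈ j)))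
                 (≈ᴹ-sym (combination-* (t i) (c j) g))) ⟩
      combination (c (punchIn j i)) g +ᴹ combination (λ l → t i * c j l) g
        ⟨V⟩.≈⟨ combination-+ (c (punchIn j i)) (λ l → t i * c j l) g ⟨
      combination d g
        ⟨V⟩.≈⟨ +ᴹ-congʳ (≈ᴹ-trans (*ₗ-congʳ d₀≈0) (*ₗ-zeroˡ _)) ⟩
      0ᴹ +ᴹ combination (tail d) (tail g)
        ⟨V⟩.≈⟨ +ᴹ-identityˡ _ ⟩
      combination (tail d) (tail g) ⟨V⟩.∎)
      where
      d : Fin (suc n) → Carrier
      d l = c (punchIn j i) l + t i * c j l
      d₀≈0 : d zero ≈ 0#
      d₀≈0 = ⟨R⟩.begin
        c (punchIn j i) zero + t i * c j zero
          ⟨R⟩.≈⟨ +-congˡ (-‿distribˡ-* _ _) ⟨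
        c (punchIn j i) zero + - (c (punchIn j i) zero * c j zero ⁻¹ * c j zero)
          ⟨R⟩.≈⟨ +-congˡ (-‿cong (trans (*-assoc _ _ _)
                   (trans (*-congˡ (⁻¹-inverseˡ pivot≉0)) (*-identityʳ _)))) ⟩
        c (punchIn j i) zero + - c (punchIn j i) zero
          ⟨R⟩.≈⟨ -‿inverseʳ _ ⟩
        0# ⟨R⟩.∎

  -- A vector outside the span of `b` could be put in front of it, giving `suc k` independent
  -- vectors in the span of `n ≤ k` generators.
  independent-maximal : ∀ {n k v} {g : Fin n → Carrierᴹ} {b : Fin k → Carrierᴹ} →
                        LinearlyIndependent b → (∀ i → SpannedBy g (b i)) → n ℕ.≤ k →
                        SpannedBy g v → SpannedBy b v
  independent-maximal {v = v} {g} {b} indep b∈ n≤k v∈ = decidable-stable em λ v∉ →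
    ℕ.<-irrefl ≡.refl (ℕ.≤-trans
      (independent-size {g = g} {b = v Vector.∷ b} (independent-∷ {b = b} indep v∉)
        λ { zero → v∈ ; (suc i) → b∈ i }) n≤k)

  -- Greedy choice: as long as some vector of `A` is not yet spanned, it is added. The basis
  -- consists of elements of `A` itself.
  basis : ∀ (A : Pred Carrierᴹ ℓ) {n} (g : Fin n → Carrierᴹ) → (∀ {v} → A v → SpannedBy g v) →
          ∃[ k ] Σ (Fin k → Carrierᴹ) λ b →
          k ℕ.≤ n × LinearlyIndependent b × (∀ i → A (b i)) × (∀ {v} → A v → SpannedBy b v)
  basis A {n} g A⊆ = extend n 0 (λ ()) (λ _ _ ()) (λ ()) (ℕ.m≤m+n n 0)
    where
    -- The invariant `n ℕ.≤ fuel ℕ.+ k` means that when the fuel is used up there are already `n`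
    -- independent vectors, and one more would contradict `independent-size`.
    extend : ∀ fuel k (b : Fin k → Carrierᴹ) → LinearlyIndependent b → (∀ i → A (b i)) →
             n ℕ.≤ fuel ℕ.+ k →
             ∃[ k ] Σ (Fin k → Carrierᴹ) λ b →
             k ℕ.≤ n × LinearlyIndependent b × (∀ i → A (b i)) × (∀ {v} → A v → SpannedBy b v)
    extend fuel k b indep b∈A n≤ with em {P = ∃[ v ] (A v × ¬ SpannedBy b v)}
    ... | no  spans = k , b , independent-size {g = g} indep (A⊆ ∘ b∈A) , indep , b∈A
                    , λ v∈A → decidable-stable em λ v∉ → spans (_ , v∈A , v∉)
    extend zero k b indep b∈A n≤ | yes (v , v∈A , v∉) = contradiction
      (ℕ.≤-trans (independent-size {g = g} {b = v Vector.∷ b} (independent-∷ {b = b} indep v∉)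
        λ { zero → A⊆ v∈A ; (suc i) → A⊆ (b∈A i) }) n≤) (ℕ.<-irrefl ≡.refl)
    extend (suc fuel) k b indep b∈A n≤ | yes (v , v∈A , v∉) =
      extend fuel (suc k) (v Vector.∷ b) (independent-∷ {b = b} indep v∉)
        (λ { zero → v∈A ; (suc i) → b∈A i })
        (≡.subst (n ℕ.≤_) (≡.sym (ℕ.+-suc fuel k)) n≤)

  -- Carathéodory's theorem.

  argmin : ∀ {n} (P : Pred (Fin n) ℓ) (f : Fin n → Carrier) → ∃ P →
           ∃[ i ] (P i × ∀ j → P j → f i ≤ f j)
  argmin {suc n} P f ∃P with em {P = ∃ (P ∘ suc)}
  argmin {suc n} P f (zero , P₀) | no none =
    zero , P₀ , λ { zero _ → ≤-refl ; (suc j) Pⱼ → contradiction (j , Pⱼ) none }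
  argmin {suc n} P f (suc j , Pⱼ) | no none = contradiction (j , Pⱼ) none
  ... | yes some with argmin (P ∘ suc) (f ∘ suc) some | em {P = P zero}
  ... | i , Pᵢ , min | no ¬P₀ = suc i , Pᵢ , λ
    { zero P₀ → contradiction P₀ ¬P₀ ; (suc j) Pⱼ → min j Pⱼ }
  ... | i , Pᵢ , min | yes P₀ with total (f zero) (f (suc i))
  ... | inj₁ f₀≤ = zero , P₀ , λ { zero _ → ≤-refl ; (suc j) Pⱼ → ≤-trans f₀≤ (min j Pⱼ) }
  ... | inj₂ ≤f₀ = suc i , Pᵢ , λ { zero _ → ≤f₀ ; (suc j) Pⱼ → min j Pⱼ }

  -- If no relation had a positive coefficient, the same would hold for its negative, so every
  -- relation would be trivial.
  positive-relation : ∀ {n} {a : Fin n → Carrierᴹ} → ¬ LinearlyIndependent a →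
                      ∃[ r ] (combination r a ≈ᴹ 0ᴹ × ∃[ i ] (0# < r i))
  positive-relation {n} {a} dep with em {P = ∃[ r ] (combination r a ≈ᴹ 0ᴹ × ∃[ i ] (0# < r i))}
  ... | yes rel = rel
  ... | no none = contradiction (λ r eq i → antisym
      (nonpos r eq i)
      (≤-respʳ-≈ (trans (-‿cong (-1*x≈-x (r i))) (-‿involutive (r i)))
        (x≤0⇒0≤-x (nonpos (λ j → - 1# * r j)
          (≈ᴹ-trans (combination-* (- 1#) r a) (≈ᴹ-trans (*ₗ-congˡ eq) (*ₗ-zeroʳ _))) i)))) dep
    where
    nonpos : ∀ r → combination r a ≈ᴹ 0ᴹ → ∀ i → r i ≤ 0#
    nonpos r eq i with total (r i) 0#
    ... | inj₁ r≤0 = r≤0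
    ... | inj₂ 0≤r with em {P = 0# ≈ r i}
    ... | yes 0≈r = ≤-reflexive (sym 0≈r)
    ... | no  0≉r = contradiction (r , eq , i , 0≤r , 0≉r) none

  -- Subtract the multiple of a relation at which the first coefficient vanishes.
  carathéodory : ∀ (A : Pred Carrierᴹ ℓ) {n v} (a : Fin n → Carrierᴹ) → (∀ i → A (a i)) →
                 Combinationᴾ (0# ≤_) a v →
                 ∃[ k ] Σ (Fin k → Carrierᴹ) λ b →
                 LinearlyIndependent b × (∀ i → A (b i)) × Combinationᴾ (0# ≤_) b v
  carathéodory A {n} {v} a a∈A (c , 0≤c , v≈) with em {P = LinearlyIndependent a}
  ... | yes indep = n , a , indep , a∈A , c , 0≤c , v≈
  carathéodory A {zero} a a∈A _ | no dep = contradiction (λ _ _ ()) dep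
  carathéodory A {suc n} {v} a a∈A (c , 0≤c , v≈) | no dep
    with positive-relation {a = a} dep
  ... | r , ra≈0 , positive with argmin (λ i → 0# < r i) (λ i → c i * r i ⁻¹) positive
  ... | i , 0<rᵢ , min = carathéodory A (removeAt a i) (a∈A ∘ punchIn i)
    (removeAt c′ i , 0≤c′ ∘ punchIn i , (⟨V⟩.begin
      v                                         ⟨V⟩.≈⟨ v≈ ⟩
      combination c a                           ⟨V⟩.≈⟨ +ᴹ-identityʳ _ ⟨
      combination c a +ᴹ 0ᴹ                     ⟨V⟩.≈⟨ +ᴹ-congˡ (≈ᴹ-trans (*ₗ-congˡ ra≈0) (*ₗ-zeroʳ _)) ⟨
      combination c a +ᴹ (- t) *ₗ combination r a ⟨V⟩.≈⟨ +ᴹ-congˡ (combination-* (- t) r a) ⟨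
      combination c a +ᴹ combination (λ j → - t * r j) a ⟨V⟩.≈⟨ combination-+ c (λ j → - t * r j) a ⟨
      combination c′ a                          ⟨V⟩.≈⟨ sum-remove {i = i} (λ j → c′ j *ₗ a j) ⟩
      c′ i *ₗ a i +ᴹ combination (removeAt c′ i) (removeAt a i)
        ⟨V⟩.≈⟨ +ᴹ-congʳ (≈ᴹ-trans (*ₗ-congʳ c′ᵢ≈0) (*ₗ-zeroˡ _)) ⟩
      0ᴹ +ᴹ combination (removeAt c′ i) (removeAt a i) ⟨V⟩.≈⟨ +ᴹ-identityˡ _ ⟩
      combination (removeAt c′ i) (removeAt a i) ⟨V⟩.∎))
    where
    t : Carrier
    -- The least ratio over the indices with positive `r j`: the largest multiple of the relation
    -- that can be subtracted while all coefficients stay nonnegative.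
    t = c i * r i ⁻¹
    c′ : Fin (suc n) → Carrier
    c′ j = c j + - t * r j
    ratio : ∀ {j} → 0# < r j → c j * r j ⁻¹ * r j ≈ c j
    ratio {j} (_ , 0≉rⱼ) = trans (*-assoc _ _ _)
      (trans (*-congˡ (⁻¹-inverseˡ (0≉rⱼ ∘ sym))) (*-identityʳ (c j)))
    c′ᵢ≈0 : c′ i ≈ 0#
    c′ᵢ≈0 = trans (+-congˡ (trans (sym (-‿distribˡ-* t (r i))) (-‿cong (ratio 0<rᵢ)))) (-‿inverseʳ (c i))
    0≤t : 0# ≤ t
    0≤t = *-nonneg (0≤c i) (proj₁ (⁻¹-pos 0<rᵢ))
    nonpos-case : ∀ j → r j ≤ 0# → 0# ≤ c′ j
    nonpos-case j r≤0 = +-nonneg (0≤c j) (≤-respʳ-≈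
      (trans (sym (-‿distribʳ-* t (r j))) (-‿distribˡ-* t (r j)))
      (*-nonneg 0≤t (x≤0⇒0≤-x r≤0)))
    -- For `r j` positive, `c′ j` equals `(c j * r j ⁻¹ + - t) * r j`, which is nonnegative since
    -- `t` is minimal. For other `j` subtracting `t * r j` cannot decrease the coefficient.
    0≤c′ : ∀ j → 0# ≤ c′ j
    0≤c′ j with total (r j) 0#
    ... | inj₁ r≤0 = nonpos-case j r≤0
    ... | inj₂ 0≤r with em {P = 0# ≈ r j}
    ... | yes 0≈r = nonpos-case j (≤-reflexive (sym 0≈r))
    ... | no  0≉r = ≤-respʳ-≈ (trans (distribʳ (r j) _ _) (+-congʳ (ratio (0≤r , 0≉r))))
      (*-nonneg (x≤y⇒0≤y-x (min j (0≤r , 0≉r))) 0≤r)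

  -- Spans and cones as inductive hulls.

  -- K is the set of admissible coefficients: everything for spans, the nonnegative scalars for cones.
  data Hull (K : Pred Carrier ℓ) (A : Pred Carrierᴹ ℓ) (v : Carrierᴹ) : Set ℓ where
    nil  : v ≈ᴹ 0ᴹ → Hull K A v
    cons : ∀ {c a u} → K c → A a → Hull K A u → v ≈ᴹ c *ₗ a +ᴹ u → Hull K A v

  Span Cone : Pred Carrierᴹ ℓ → Pred Carrierᴹ ℓ
  Span = Hull (λ _ → ⊤)
  Cone = Hull (0# ≤_)

  hull-combination : ∀ {K A n} (c : Fin n → Carrier) (a : Fin n → Carrierᴹ) →
                     (∀ i → K (c i)) → (∀ i → A (a i)) → Hull K A (combination c a)
  hull-combination {n = zero}  c a Kc Aa = nil ≈ᴹ-refl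
  hull-combination {n = suc n} c a Kc Aa =
    cons (Kc zero) (Aa zero) (hull-combination (tail c) (tail a) (Kc ∘ suc) (Aa ∘ suc)) ≈ᴹ-refl

  hull-resp : ∀ {K A u v} → u ≈ᴹ v → Hull K A u → Hull K A v
  hull-resp u≈v (nil u≈0)         = nil (≈ᴹ-trans (≈ᴹ-sym u≈v) u≈0)
  hull-resp u≈v (cons Kc Aa h eq) = cons Kc Aa h (≈ᴹ-trans (≈ᴹ-sym u≈v) eq)

  hull⇒combination : ∀ {K A v} → Hull K A v → ∃[ n ] Σ (Fin n → Carrier) λ c →
    Σ (Fin n → Carrierᴹ) λ a → (∀ i → K (c i)) × (∀ i → A (a i)) × v ≈ᴹ combination c a
  hull⇒combination (nil v≈0) = 0 , (λ ()) , (λ ()) , (λ ()) , (λ ()) , v≈0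
  hull⇒combination (cons {c₀} {a₀} Kc Aa h eq) with hull⇒combination h
  ... | n , c , a , Kcs , Aas , eq′ = suc n , c₀ Vector.∷ c , a₀ Vector.∷ a
      , (λ { zero → Kc ; (suc i) → Kcs i }) , (λ { zero → Aa ; (suc i) → Aas i })
      , ≈ᴹ-trans eq (+ᴹ-congˡ eq′)

  span⇒Span : ∀ {A v} → span A v → Span A v
  span⇒Span (n , c , a , Aa , eq) = hull-resp (≈ᴹ-sym eq) (hull-combination c a (λ _ → tt) Aa)

  Span⇒span : ∀ {A v} → Span A v → span A v
  Span⇒span h with hull⇒combination h
  ... | n , c , a , _ , Aa , eq = n , c , a , Aa , eq

  cone⇒Cone : ∀ {A v} → cone A v → Cone A v
  cone⇒Cone (n , c , a , Kc , Aa , eq) = hull-resp (≈ᴹ-sym eq) (hull-combination c a Kc Aa)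

  Cone⇒cone : ∀ {A v} → Cone A v → cone A v
  Cone⇒cone = hull⇒combination

  hull-+ : ∀ {K A u v} → Hull K A u → Hull K A v → Hull K A (u +ᴹ v)
  hull-+ (nil u≈0) h = hull-resp (≈ᴹ-sym (≈ᴹ-trans (+ᴹ-congʳ u≈0) (+ᴹ-identityˡ _))) h
  hull-+ (cons Kc Aa h eq) h′ =
    cons Kc Aa (hull-+ h h′) (≈ᴹ-trans (+ᴹ-congʳ eq) (+ᴹ-assoc _ _ _))

  hull-scale : ∀ {K A s v} → (∀ {c} → K c → K (s * c)) → Hull K A v → Hull K A (s *ₗ v)
  hull-scale sK (nil v≈0) = nil (≈ᴹ-trans (*ₗ-congˡ v≈0) (*ₗ-zeroʳ _))
  hull-scale sK (cons Kc Aa h eq) = cons (sK Kc) Aa (hull-scale sK h)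
    (≈ᴹ-trans (*ₗ-congˡ eq) (≈ᴹ-trans (*ₗ-distribˡ _ _ _) (+ᴹ-congʳ (≈ᴹ-sym (*ₗ-assoc _ _ _)))))

  hull-bind : ∀ {K A B} → (∀ {c d} → K c → K d → K (c * d)) →
              (∀ {a} → A a → Hull K B a) → ∀ {v} → Hull K A v → Hull K B v
  hull-bind K* A⊆ (nil v≈0)         = nil v≈0
  hull-bind K* A⊆ (cons Kc Aa h eq) = hull-resp (≈ᴹ-sym eq)
    (hull-+ (hull-scale (K* Kc) (A⊆ Aa)) (hull-bind K* A⊆ h))

  record IsLinear (f : Carrierᴹ → Carrierᴹ) : Set ℓ where
    field
      cong  : ∀ {u v} → u ≈ᴹ v → f u ≈ᴹ f v
      +-hom : ∀ u v → f (u +ᴹ v) ≈ᴹ f u +ᴹ f v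
      *-hom : ∀ c v → f (c *ₗ v) ≈ᴹ c *ₗ f v

    0-hom : f 0ᴹ ≈ᴹ 0ᴹ
    0-hom = ≈ᴹ-trans (cong (≈ᴹ-sym (*ₗ-zeroˡ 0ᴹ))) (≈ᴹ-trans (*-hom 0# 0ᴹ) (*ₗ-zeroˡ _))

  hull-map : ∀ {K A B f} → IsLinear f → (∀ {a} → A a → B (f a)) → ∀ {v} → Hull K A v → Hull K B (f v)
  hull-map lin AB (nil v≈0) = nil (≈ᴹ-trans (IsLinear.cong lin v≈0) (IsLinear.0-hom lin))
  hull-map lin AB (cons Kc Aa h eq) = cons Kc (AB Aa) (hull-map lin AB h)
    (≈ᴹ-trans (IsLinear.cong lin eq) (≈ᴹ-trans (IsLinear.+-hom lin _ _) (+ᴹ-congʳ (IsLinear.*-hom lin _ _))))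

  Cone-scale : ∀ {A s v} → 0# ≤ s → Cone A v → Cone A (s *ₗ v)
  Cone-scale 0≤s = hull-scale (*-nonneg 0≤s)

  Cone-bind : ∀ {A B} → (∀ {a} → A a → Cone B a) → ∀ {v} → Cone A v → Cone B v
  Cone-bind = hull-bind *-nonneg

  Span-bind : ∀ {A B} → (∀ {a} → A a → Span B a) → ∀ {v} → Span A v → Span B v
  Span-bind = hull-bind (λ _ _ → tt)

  hull-member : ∀ {K A v} → K 1# → A v → Hull K A v
  hull-member K1 Av = cons K1 Av (nil ≈ᴹ-refl)
    (≈ᴹ-sym (≈ᴹ-trans (+ᴹ-identityʳ _) (*ₗ-identityˡ _)))

  Cone-member : ∀ {A v} → A v → Cone A v
  Cone-member = hull-member (proj₁ 0<1)

  Span-member : ∀ {A v} → A v → Span A v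
  Span-member = hull-member tt

  Cone⇒Span : ∀ {A v} → Cone A v → Span A v
  Cone⇒Span (nil v≈0)        = nil v≈0
  Cone⇒Span (cons _ Aa h eq) = cons tt Aa (Cone⇒Span h) eq

  -- A negative coefficient is made positive by passing to the opposite vector, which also belongs
  -- to `A`.
  Span⇒Cone : ∀ {A} → (∀ {v} → A v → A (-ᴹ v)) → ∀ {v} → Span A v → Cone A v
  Span⇒Cone A-sym (nil v≈0) = nil v≈0
  Span⇒Cone A-sym (cons {c} {a} _ Aa h eq) with total 0# c
  ... | inj₁ 0≤c = cons 0≤c Aa (Span⇒Cone A-sym h) eq
  ... | inj₂ c≤0 = cons (x≤0⇒0≤-x c≤0) (A-sym Aa) (Span⇒Cone A-sym h)
    (≈ᴹ-trans eq (+ᴹ-congʳ (⟨V⟩.begin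
      c *ₗ a                      ⟨V⟩.≈⟨ *ₗ-congʳ (trans (*-comm _ _) (trans (-1*x≈-x _) (-‿involutive c))) ⟨
      (- c * - 1#) *ₗ a           ⟨V⟩.≈⟨ *ₗ-assoc _ _ _ ⟩
      (- c) *ₗ ((- 1#) *ₗ a)      ⟨V⟩.≈⟨ *ₗ-congˡ (neg≈-1 a) ⟨
      (- c) *ₗ (-ᴹ a)             ⟨V⟩.∎)))

  -- The new term is merged into the coefficient at `i`. Repeated generators collapse in this way,
  -- and the family keeps its length.
  Combinationᴾ-cons : ∀ {K n c u v} (b : Fin n → Carrierᴹ) i → (∀ {c d} → K c → K d → K (c + d)) →
    K c → Combinationᴾ K b u → v ≈ᴹ c *ₗ b i +ᴹ u → Combinationᴾ K b v
  Combinationᴾ-cons b zero K+ Kc (d , Kd , eq) eq′ =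
    (_ Vector.∷ tail d) , (λ { zero → K+ Kc (Kd zero) ; (suc j) → Kd (suc j) })
    , ≈ᴹ-trans eq′ (≈ᴹ-trans (+ᴹ-congˡ eq) (≈ᴹ-trans (≈ᴹ-sym (+ᴹ-assoc _ _ _))
        (+ᴹ-congʳ (≈ᴹ-sym (*ₗ-distribʳ _ _ _)))))
  Combinationᴾ-cons b (suc i) K+ Kc (d , Kd , eq) eq′
    with Combinationᴾ-cons (tail b) i K+ Kc (tail d , Kd ∘ suc , ≈ᴹ-refl) ≈ᴹ-refl
  ... | e , Ke , eq″ = (d zero Vector.∷ e) , (λ { zero → Kd zero ; (suc j) → Ke j })
    , ≈ᴹ-trans eq′ (≈ᴹ-trans (+ᴹ-congˡ eq) (≈ᴹ-trans (x∙yz≈y∙xz _ _ _) (+ᴹ-congˡ eq″)))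

  hull-range : ∀ {K n v} (b : Fin n → Carrierᴹ) → K 0# → (∀ {c d} → K c → K d → K (c + d)) →
               Hull K (range b) v → Combinationᴾ K b v
  hull-range b K0 K+ (nil v≈0) = (λ _ → 0#) , (λ _ → K0) , ≈ᴹ-trans v≈0 (≈ᴹ-sym (combination-0 b))
  hull-range b K0 K+ (cons Kc (i , a≈) h eq) =
    Combinationᴾ-cons b i K+ Kc (hull-range b K0 K+ h) (≈ᴹ-trans eq (+ᴹ-congʳ (*ₗ-congˡ a≈)))

  Cone-range : ∀ {n v} (b : Fin n → Carrierᴹ) → Cone (range b) v → Combinationᴾ (0# ≤_) b v
  Cone-range b = hull-range b ≤-refl +-nonneg

  Span-range : ∀ {n v} (b : Fin n → Carrierᴹ) → Span (range b) v → SpannedBy b v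
  Span-range b h with hull-range b tt (λ _ _ → tt) h
  ... | c , _ , eq = c , eq

  SpannedBy⇒Span : ∀ {n v} (b : Fin n → Carrierᴹ) → SpannedBy b v → Span (range b) v
  SpannedBy⇒Span b (c , eq) =
    hull-resp (≈ᴹ-sym eq) (hull-combination c b (λ _ → tt) (λ i → i , ≈ᴹ-refl))

  basis⇒dimension : ∀ {A k} {b : Fin k → Carrierᴹ} → LinearlyIndependent b →
                    (∀ i → Span A (b i)) → (∀ {v} → A v → SpannedBy b v) → HasDimension (span A) k
  basis⇒dimension {A} {k} {b} indep b∈ A⊆ = b , indep
    , (λ h → Span⇒span (Span-bind {A} {range b} (SpannedBy⇒Span b ∘ A⊆) (span⇒Span h)))
    , (λ h → Span⇒span (Span-bind {range b} {A} (λ { (i , v≈) → hull-resp (≈ᴹ-sym v≈) (b∈ i) })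
        (span⇒Span h)))

  -- By independence the coefficients of `u` and `v` add up to zero; being nonnegative, they all
  -- vanish.
  independent-cone-pointed : ∀ {n u v} {b : Fin n → Carrierᴹ} → LinearlyIndependent b →
    Cone (range b) u → Cone (range b) v → u +ᴹ v ≈ᴹ 0ᴹ → u ≈ᴹ 0ᴹ
  independent-cone-pointed {u = u} {v} {b} indep hu hv u+v≈0
    with Cone-range b hu | Cone-range b hv
  ... | c , 0≤c , u≈ | d , 0≤d , v≈ =
    ≈ᴹ-trans u≈ (≈ᴹ-trans (combination-cong b c≈0) (combination-0 b))
    where
    c+d≈0 : ∀ i → c i + d i ≈ 0#
    c+d≈0 = indep (λ i → c i + d i) (≈ᴹ-trans (combination-+ c d b)
      (≈ᴹ-trans (+ᴹ-cong (≈ᴹ-sym u≈) (≈ᴹ-sym v≈)) u+v≈0))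
    c≈0 : ∀ i → c i ≈ 0#
    c≈0 i = antisym (≤-respʳ-≈ (c+d≈0 i)
      (≤-respˡ-≈ (+-identityˡ (c i)) (≤-respʳ-≈ (+-comm (d i) (c i)) (+-monoˡ-≤ (c i) (0≤d i))))) (0≤c i)

  independent-tail : ∀ {n} {b : Fin (suc n) → Carrierᴹ} → LinearlyIndependent b →
                     LinearlyIndependent (tail b)
  independent-tail {b = b} indep c eq i = indep (0# Vector.∷ c)
    (≈ᴹ-trans (+ᴹ-cong (*ₗ-zeroˡ _) eq) (+ᴹ-identityˡ 0ᴹ)) (suc i)

  independent-head : ∀ {n} {b : Fin (suc n) → Carrierᴹ} → LinearlyIndependent b →
                     ¬ Span (range (tail b)) (b zero)
  independent-head {b = b} indep h with Span-range (tail b) h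
  ... | c , eq = 0≉1 (trans (sym (trans (-‿cong (indep (- 1# Vector.∷ c) (⟨V⟩.begin
    (- 1#) *ₗ b zero +ᴹ combination c (tail b) ⟨V⟩.≈⟨ +ᴹ-cong (≈ᴹ-sym (neg≈-1 _)) (≈ᴹ-sym eq) ⟩
    -ᴹ b zero +ᴹ b zero                        ⟨V⟩.≈⟨ -ᴹ‿inverseˡ _ ⟩
    0ᴹ                                         ⟨V⟩.∎) zero)) -0#≈0#)) (-‿involutive 1#))

-- Roots and the action of the Coxeter group.

module RootProperties {ℓ} (em : ∀ {a} → ExcludedMiddle a) (ℝ : RealNumbers ℓ) (Φ : RootSystem ℝ) where
  open RealNumbers ℝ hiding (zero)
  open RootSystem Φ
  open Roots Φ hiding (neg≈-1)
  open OrderedFieldProperties ℝ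
  open LinearAlgebra em ℝ V
  open OrientedMatroidProperties em Φ̄ neg
  open Subset
  open IsTotalOrder isTotalOrder using (total; antisym; ≤-respˡ-≈; ≤-respʳ-≈)
    renaming (refl to ≤-refl; reflexive to ≤-reflexive)
  open RingProperties ring using (x∙y⁻¹≈ε⇒x≈y)
  open AbelianGroupProperties +ᴹ-abelianGroup using ()
    renaming (⁻¹-∙-comm to -ᴹ-+ᴹ; ⁻¹-involutive to -ᴹ-involutive; ∙-cancelˡ to +ᴹ-cancelˡ)
  open CommutativeSemigroupProperties
    (CommutativeMonoid.commutativeSemigroup +ᴹ-commutativeMonoid)
    using (interchange; x∙yz≈y∙xz)
  private
    module ⟨V⟩ = SetoidReasoning ≈ᴹ-setoid

  reflect-+ : ∀ α u v → reflect α (u +ᴹ v) ≈ᴹ reflect α u +ᴹ reflect α v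
  reflect-+ α u v = ⟨V⟩.begin
    (u +ᴹ v) +ᴹ -ᴹ (k (u +ᴹ v) *ₗ α)
      ⟨V⟩.≈⟨ +ᴹ-congˡ (-ᴹ‿cong (≈ᴹ-trans (*ₗ-congʳ k-+) (*ₗ-distribʳ α _ _))) ⟩
    (u +ᴹ v) +ᴹ -ᴹ (k u *ₗ α +ᴹ k v *ₗ α)
      ⟨V⟩.≈⟨ +ᴹ-congˡ (-ᴹ-+ᴹ _ _) ⟨
    (u +ᴹ v) +ᴹ (-ᴹ (k u *ₗ α) +ᴹ -ᴹ (k v *ₗ α))
      ⟨V⟩.≈⟨ interchange _ _ _ _ ⟩
    reflect α u +ᴹ reflect α v ⟨V⟩.∎
    where
    k : Carrierᴹ → Carrier
    k v = (1# + 1#) * ⟨ v ∣ α ⟩ * ⟨ α ∣ α ⟩ ⁻¹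
    k-+ : k (u +ᴹ v) ≈ k u + k v
    k-+ = trans (*-congʳ (trans (*-congˡ (⟨⟩-+ˡ u v α)) (distribˡ _ _ _))) (distribʳ _ _ _)

  act-linear : ∀ w → IsLinear (act w)
  act-linear w = record { cong = act-cong w ; +-hom = act-+ w ; *-hom = act-scale w }
    where
    act-+ : ∀ w u v → act w (u +ᴹ v) ≈ᴹ act w u +ᴹ act w v
    act-+ []      u v = ≈ᴹ-refl
    act-+ (i ∷ w) u v = ≈ᴹ-trans (act-cong [ i ] (act-+ w u v)) (reflect-+ (simple i) _ _)

  -ᴹ-linear : IsLinear -ᴹ_
  -ᴹ-linear = record
    { cong = -ᴹ‿cong ; +-hom = λ u v → ≈ᴹ-sym (-ᴹ-+ᴹ u v) ; *-hom = -ᴹ-*ₗ }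

  reflect-involutive : ∀ i v → reflect (simple i) (reflect (simple i) v) ≈ᴹ v
  reflect-involutive i v = ⟨V⟩.begin
    reflect α (v +ᴹ -ᴹ (k *ₗ α))                ⟨V⟩.≈⟨ reflect-+ α v _ ⟩
    reflect α v +ᴹ reflect α (-ᴹ (k *ₗ α))      ⟨V⟩.≈⟨ +ᴹ-congˡ (act-neg [ i ] _) ⟩
    reflect α v +ᴹ -ᴹ reflect α (k *ₗ α)        ⟨V⟩.≈⟨ +ᴹ-congˡ (-ᴹ‿cong (reflect-scale α k α)) ⟩
    reflect α v +ᴹ -ᴹ (k *ₗ reflect α α)        ⟨V⟩.≈⟨ +ᴹ-congˡ (-ᴹ-*ₗ k _) ⟩
    reflect α v +ᴹ k *ₗ (-ᴹ reflect α α)        ⟨V⟩.≈⟨ +ᴹ-congˡ (*ₗ-congˡ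
                                                     (≈ᴹ-trans (-ᴹ‿cong (reflect-simple i)) (-ᴹ-involutive α))) ⟩
    (v +ᴹ -ᴹ (k *ₗ α)) +ᴹ k *ₗ α                ⟨V⟩.≈⟨ +ᴹ-assoc _ _ _ ⟩
    v +ᴹ (-ᴹ (k *ₗ α) +ᴹ k *ₗ α)                ⟨V⟩.≈⟨ +ᴹ-congˡ (-ᴹ‿inverseˡ _) ⟩
    v +ᴹ 0ᴹ                                     ⟨V⟩.≈⟨ +ᴹ-identityʳ v ⟩
    v                                           ⟨V⟩.∎
    where
    α = simple i
    k = (1# + 1#) * ⟨ v ∣ α ⟩ * ⟨ α ∣ α ⟩ ⁻¹

  inverse : W → W
  inverse []      = []
  inverse (i ∷ w) = inverse w List.++ [ i ]

  act-inverseˡ : ∀ w v → act (inverse w) (act w v) ≈ᴹ v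
  act-inverseˡ []      v = ≈ᴹ-refl
  act-inverseˡ (i ∷ w) v = ≈ᴹ-trans (act-++ (inverse w) [ i ] _)
    (≈ᴹ-trans (act-cong (inverse w) (reflect-involutive i _)) (act-inverseˡ w v))

  act-inverseʳ : ∀ w v → act w (act (inverse w) v) ≈ᴹ v
  act-inverseʳ []      v = ≈ᴹ-refl
  act-inverseʳ (i ∷ w) v = ≈ᴹ-trans (act-cong (i ∷ w) (act-++ (inverse w) [ i ] v))
    (≈ᴹ-trans (act-cong [ i ] (act-inverseʳ w _)) (reflect-involutive i v))

  -- Undoing the word `w` would turn a zero root into a zero simple root, whose norm is positive.
  vector-nonzero : ∀ α → ¬ vector α ≈ᴹ 0ᴹ
  vector-nonzero (root v (w , i , v≈)) v≈0 = proj₂ (simple-pos i) (sym (trans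
    (⟨⟩-cong simple≈0 ≈ᴹ-refl)
    (trans (⟨⟩-cong (≈ᴹ-sym (*ₗ-zeroˡ 0ᴹ)) ≈ᴹ-refl) (trans (⟨⟩-*ˡ 0# 0ᴹ (simple i)) (zeroˡ _)))))
    where
    simple≈0 : simple i ≈ᴹ 0ᴹ
    simple≈0 = ≈ᴹ-trans (≈ᴹ-sym (act-inverseˡ w (simple i)))
      (≈ᴹ-trans (act-cong (inverse w) (≈ᴹ-trans (≈ᴹ-sym v≈) v≈0)) (IsLinear.0-hom (act-linear (inverse w))))

  -- A simple reflection changes a vector by a multiple of a simple root. Hence the rank bounds the
  -- size of every independent set of roots.
  root-spanned : ∀ α → SpannedBy simple (vector α)
  root-spanned (root v (w , i , v≈)) =
    Span-range simple (hull-resp (≈ᴹ-sym v≈) (act-span w (Span-member (i , ≈ᴹ-refl))))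
    where
    act-span : ∀ w {v} → Span (range simple) v → Span (range simple) (act w v)
    act-span []      h = h
    act-span (i ∷ w) h = hull-+ (act-span w h)
      (hull-resp (≈ᴹ-sym (neg≈-1 _)) (hull-scale _ (hull-scale _ (Span-member (i , ≈ᴹ-refl)))))

  vectors-spanned : ∀ X {v} → vectors X v → SpannedBy simple v
  vectors-spanned X (α , _ , v≈) with root-spanned α
  ... | c , eq = c , ≈ᴹ-trans v≈ eq

  vectors-mono : ∀ {X Y} → X ⊆ Y → ∀ {v} → vectors X v → vectors Y v
  vectors-mono X⊆Y (α , α∈X , v≈) = α , X⊆Y α∈X , v≈

  vectors-Cone-mono : ∀ {X Y} → X ⊆ Y → ∀ {v} → Cone (vectors X) v → Cone (vectors Y) v
  vectors-Cone-mono {X} {Y} X⊆Y = Cone-bind (Cone-member ∘ vectors-mono {X} {Y} X⊆Y)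

  -- The conic closure is an oriented matroid root system.

  coneΦ⇒Cone : ∀ X {x} → x ∈ coneΦ X → Cone (vectors X) (vector x)
  coneΦ⇒Cone X (β , β∈ , c , 0<c , x≈cβ) =
    hull-resp (≈ᴹ-sym x≈cβ) (Cone-scale (proj₁ 0<c) (cone⇒Cone β∈))

  Cone⇒coneΦ : ∀ X {x} → Cone (vectors X) (vector x) → x ∈ coneΦ X
  Cone⇒coneΦ X {x} h = x , Cone⇒cone h , ∼-refl {x}

  neg-cong : ∀ {α β} → α ∼ β → neg α ∼ neg β
  neg-cong (c , 0<c , α≈cβ) = c , 0<c , ≈ᴹ-trans (-ᴹ‿cong α≈cβ) (-ᴹ-*ₗ c _)

  vector-∼ : ∀ {α β} → vector α ≈ᴹ vector β → α ∼ β
  vector-∼ α≈β = 1# , 0<1 , ≈ᴹ-trans α≈β (≈ᴹ-sym (*ₗ-identityˡ _))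

  Cone-unscale : ∀ {A c v} → 0# < c → Cone A (c *ₗ v) → Cone A v
  Cone-unscale 0<c h = hull-resp (cancel-scale _ (proj₂ 0<c ∘ sym)) (Cone-scale (proj₁ (⁻¹-pos 0<c)) h)

  -- All terms on the ray of `y` are gathered into the single coefficient `s`.
  Cone-adjoin : ∀ {X y v} → Cone (vectors (X ∪ ｛ y ｝)) v →
                ∃[ s ] ∃[ u ] (0# ≤ s × Cone (vectors X) u × v ≈ᴹ s *ₗ vector y +ᴹ u)
  Cone-adjoin (nil v≈0) = 0# , 0ᴹ , ≤-refl , nil ≈ᴹ-refl
    , ≈ᴹ-trans v≈0 (≈ᴹ-sym (≈ᴹ-trans (+ᴹ-identityʳ _) (*ₗ-zeroˡ _)))
  Cone-adjoin {X} {y} (cons {c} 0≤c (α , α∈ , a≈) h eq) with Cone-adjoin {X} {y} h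
  Cone-adjoin {X} {y} (cons {c} {a} 0≤c (α , inj₁ α∈X , a≈) h eq) | s , u , 0≤s , hu , eq′ =
    s , c *ₗ a +ᴹ u , 0≤s , cons 0≤c (α , α∈X , a≈) hu ≈ᴹ-refl
    , ≈ᴹ-trans eq (≈ᴹ-trans (+ᴹ-congˡ eq′) (x∙yz≈y∙xz _ _ _))
  Cone-adjoin {X} {y} (cons {c} {a} 0≤c (α , inj₂ (d , 0<d , α≈dy) , a≈) h eq) | s , u , 0≤s , hu , eq′ =
    c * d + s , u , +-nonneg (*-nonneg 0≤c (proj₁ 0<d)) 0≤s , hu , (⟨V⟩.begin
      _                                               ⟨V⟩.≈⟨ eq ⟩
      c *ₗ a +ᴹ _                                     ⟨V⟩.≈⟨ +ᴹ-cong (*ₗ-congˡ (≈ᴹ-trans a≈ α≈dy)) eq′ ⟩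
      c *ₗ (d *ₗ vector y) +ᴹ (s *ₗ vector y +ᴹ u)    ⟨V⟩.≈⟨ +ᴹ-assoc _ _ _ ⟨
      c *ₗ (d *ₗ vector y) +ᴹ s *ₗ vector y +ᴹ u      ⟨V⟩.≈⟨ +ᴹ-congʳ (+ᴹ-congʳ (*ₗ-assoc c d _)) ⟨
      (c * d) *ₗ vector y +ᴹ s *ₗ vector y +ᴹ u       ⟨V⟩.≈⟨ +ᴹ-congʳ (*ₗ-distribʳ _ _ _) ⟨
      (c * d + s) *ₗ vector y +ᴹ u                    ⟨V⟩.∎)

  move : ∀ {s v u x} → x ≈ᴹ s *ₗ (-ᴹ v) +ᴹ u → s *ₗ v +ᴹ x ≈ᴹ u
  move {s} {v} {u} {x} eq = ⟨V⟩.begin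
    s *ₗ v +ᴹ x                      ⟨V⟩.≈⟨ +ᴹ-congˡ eq ⟩
    s *ₗ v +ᴹ (s *ₗ (-ᴹ v) +ᴹ u)     ⟨V⟩.≈⟨ +ᴹ-assoc _ _ _ ⟨
    s *ₗ v +ᴹ s *ₗ (-ᴹ v) +ᴹ u       ⟨V⟩.≈⟨ +ᴹ-congʳ (*ₗ-distribˡ s _ _) ⟨
    s *ₗ (v +ᴹ -ᴹ v) +ᴹ u            ⟨V⟩.≈⟨ +ᴹ-congʳ (≈ᴹ-trans (*ₗ-congˡ (-ᴹ‿inverseʳ v)) (*ₗ-zeroʳ s)) ⟩
    0ᴹ +ᴹ u                          ⟨V⟩.≈⟨ +ᴹ-identityˡ u ⟩
    u                                ⟨V⟩.∎

  compare : ∀ {c e v x u} → c *ₗ v +ᴹ x ≈ᴹ e *ₗ v +ᴹ u → x ≈ᴹ (e + - c) *ₗ v +ᴹ u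
  compare {c} {e} {v} {x} {u} eq = +ᴹ-cancelˡ (c *ₗ v) _ _ (⟨V⟩.begin
    c *ₗ v +ᴹ x                           ⟨V⟩.≈⟨ eq ⟩
    e *ₗ v +ᴹ u                           ⟨V⟩.≈⟨ +ᴹ-congʳ (*ₗ-congʳ e≈) ⟩
    (c + (e + - c)) *ₗ v +ᴹ u             ⟨V⟩.≈⟨ +ᴹ-congʳ (*ₗ-distribʳ v _ _) ⟩
    c *ₗ v +ᴹ (e + - c) *ₗ v +ᴹ u         ⟨V⟩.≈⟨ +ᴹ-assoc _ _ _ ⟩
    c *ₗ v +ᴹ ((e + - c) *ₗ v +ᴹ u)       ⟨V⟩.∎)
    where
    e≈ : e ≈ c + (e + - c)
    e≈ = sym (trans (+-comm _ _) (trans (+-assoc _ _ _)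
      (trans (+-congˡ (-‿inverseˡ c)) (+-identityʳ e))))

  -- An expression of `x` as `s` times its negative plus `u` says that `(1# + s)` times `x` is `u`,
  -- and `1# + s` is positive.
  coneΦ-cancel : ∀ X x → x ∈ coneΦ (X ∪ ｛ neg x ｝) → x ∈ coneΦ X
  coneΦ-cancel X x x∈ with Cone-adjoin {X} {neg x} (coneΦ⇒Cone (X ∪ ｛ neg x ｝) {x} x∈)
  ... | s , u , 0≤s , hu , eq = Cone⇒coneΦ X {x} (Cone-unscale (0<1+x 0≤s)
    (hull-resp (≈ᴹ-sym (⟨V⟩.begin
      (1# + s) *ₗ vector x            ⟨V⟩.≈⟨ *ₗ-distribʳ _ _ _ ⟩
      1# *ₗ vector x +ᴹ s *ₗ vector x ⟨V⟩.≈⟨ +ᴹ-congʳ (*ₗ-identityˡ _) ⟩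
      vector x +ᴹ s *ₗ vector x       ⟨V⟩.≈⟨ +ᴹ-comm _ _ ⟩
      s *ₗ vector x +ᴹ vector x       ⟨V⟩.≈⟨ move eq ⟩
      u                               ⟨V⟩.∎)) hu))

  -- If y ∉ X then e = 0; the last component records that multiples of y up to e lie in the cone of X.
  Cone-remove : ∀ X y {u} → Cone (vectors X) u →
    ∃[ e ] ∃[ u′ ] ( 0# ≤ e × Cone (vectors (X ∖ ｛ y ｝)) u′ × u ≈ᴹ e *ₗ vector y +ᴹ u′
                   × (∀ {r} → 0# ≤ r → r ≤ e → Cone (vectors X) (r *ₗ vector y)))
  Cone-remove X y {u} hu with em {P = y ∈ X}
  ... | no  y∉X = 0# , u , ≤-refl , vectors-Cone-mono {X} {X ∖ ｛ y ｝} (λ {x} x∈X →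
      x∈X , λ x∼y → y∉X (respect X {x} {y} x∼y x∈X)) hu
    , ≈ᴹ-sym (≈ᴹ-trans (+ᴹ-congʳ (*ₗ-zeroˡ _)) (+ᴹ-identityˡ u))
    , λ 0≤r r≤0 → nil (≈ᴹ-trans (*ₗ-congʳ (antisym r≤0 0≤r)) (*ₗ-zeroˡ _))
  ... | yes y∈X with Cone-adjoin {X ∖ ｛ y ｝} {y} (vectors-Cone-mono {X} {X ∖ ｛ y ｝ ∪ ｛ y ｝} back hu)
    where
    back : X ⊆ X ∖ ｛ y ｝ ∪ ｛ y ｝
    back {x} x∈X with em {P = x ∼ y}
    ... | yes x∼y = inj₂ x∼y
    ... | no  x≁y = inj₁ (x∈X , x≁y)
  ... | e , u′ , 0≤e , hu′ , eq = e , u′ , 0≤e , hu′ , eq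
    , λ 0≤r _ → Cone-scale 0≤r (Cone-member (y , y∈X , ≈ᴹ-refl))

  -- Writing `x` as `u` minus `s` times `y`, and splitting `u` into `e` times `y` plus `u′`, gives
  -- one equation between `x`, `y` and `u′`. If `s ≤ e`, it shows `x` in the cone of `X`, which is
  -- excluded. So `s` exceeds `e`, and `u′` minus `x` is a positive multiple of `y`.
  coneΦ-exchange : ∀ X x y → x ∈ coneΦ (X ∪ ｛ neg y ｝) → x ∉ coneΦ X →
                   y ∈ coneΦ ((X ∖ ｛ y ｝) ∪ ｛ neg x ｝)
  coneΦ-exchange X x y x∈ x∉ with Cone-adjoin {X} {neg y} (coneΦ⇒Cone (X ∪ ｛ neg y ｝) {x} x∈)
  ... | s , u , 0≤s , hu , eq with Cone-remove X y hu
  ... | e , u′ , 0≤e , hu′ , eq′ , multiples = result (total s e)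
    where
    Y = (X ∖ ｛ y ｝) ∪ ｛ neg x ｝
    sy+x≈ey+u′ : s *ₗ vector y +ᴹ vector x ≈ᴹ e *ₗ vector y +ᴹ u′
    sy+x≈ey+u′ = ≈ᴹ-trans (move eq) eq′
    s≰e : ¬ s ≤ e
    s≰e s≤e = x∉ (Cone⇒coneΦ X {x} (hull-resp (≈ᴹ-sym (compare sy+x≈ey+u′))
      (hull-+ (multiples (x≤y⇒0≤y-x s≤e) e-s≤e)
              (vectors-Cone-mono {X ∖ ｛ y ｝} {X} proj₁ hu′))))
      where
      e-s≤e : e + - s ≤ e
      e-s≤e = ≤-respʳ-≈ (+-identityˡ e)
        (≤-respˡ-≈ (+-comm (- s) e) (+-monoˡ-≤ e (0≤x⇒-x≤0 0≤s)))
    result : s ≤ e ⊎ e ≤ s → y ∈ coneΦ Y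
    result (inj₁ s≤e) = contradiction s≤e s≰e
    result (inj₂ e≤s) = Cone⇒coneΦ Y {y} (Cone-unscale
      (x≤y⇒0≤y-x e≤s , λ 0≈s-e → s≰e (≤-reflexive (s≈e 0≈s-e)))
      (hull-resp eq″ (hull-+ (vectors-Cone-mono {X ∖ ｛ y ｝} {Y} inj₁ hu′)
        (Cone-member (neg x , inj₂ (∼-refl {neg x}) , ≈ᴹ-refl)))))
      where
      s≈e : 0# ≈ s + - e → s ≈ e
      s≈e 0≈ = x∙y⁻¹≈ε⇒x≈y s e (sym 0≈)
      eq″ : u′ +ᴹ -ᴹ vector x ≈ᴹ (s + - e) *ₗ vector y
      eq″ = ⟨V⟩.begin
        u′ +ᴹ -ᴹ vector x
          ⟨V⟩.≈⟨ +ᴹ-congʳ (compare (≈ᴹ-sym sy+x≈ey+u′)) ⟩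
        (s + - e) *ₗ vector y +ᴹ vector x +ᴹ -ᴹ vector x
          ⟨V⟩.≈⟨ +ᴹ-assoc _ _ _ ⟩
        (s + - e) *ₗ vector y +ᴹ (vector x +ᴹ -ᴹ vector x)
          ⟨V⟩.≈⟨ +ᴹ-congˡ (-ᴹ‿inverseʳ _) ⟩
        (s + - e) *ₗ vector y +ᴹ 0ᴹ
          ⟨V⟩.≈⟨ +ᴹ-identityʳ _ ⟩
        (s + - e) *ₗ vector y ⟨V⟩.∎

  Cone-finitary : ∀ X {v} → Cone (vectors X) v →
                  ∃[ ys ] (All (_∈ X) ys × Cone (vectors (fromList ys)) v)
  Cone-finitary X (nil v≈0) = [] , [] , nil v≈0
  Cone-finitary X (cons 0≤c (α , α∈X , a≈) h eq) with Cone-finitary X h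
  ... | ys , ys∈X , h′ = α ∷ ys , α∈X ∷ ys∈X
    , cons 0≤c (α , here (∼-refl {α}) , a≈)
        (vectors-Cone-mono {fromList ys} {fromList (α ∷ ys)} there h′) eq

  coneΦ-mono : ∀ {X Y} → X ⊆ Y → coneΦ X ⊆ coneΦ Y
  coneΦ-mono {X} {Y} X⊆Y {x} x∈ =
    Cone⇒coneΦ Y {x} (vectors-Cone-mono {X} {Y} X⊆Y (coneΦ⇒Cone X {x} x∈))

  coneΦ-bind : ∀ {X Y} → X ⊆ coneΦ Y → coneΦ X ⊆ coneΦ Y
  coneΦ-bind {X} {Y} X⊆ {x} x∈ = Cone⇒coneΦ Y {x} (Cone-bind
    (λ (α , α∈X , v≈) → hull-resp (≈ᴹ-sym v≈) (coneΦ⇒Cone Y {α} (X⊆ α∈X))) (coneΦ⇒Cone X {x} x∈))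

  coneΦ-extensive : ∀ X → X ⊆ coneΦ X
  coneΦ-extensive X {x} x∈X = Cone⇒coneΦ X {x} (Cone-member (x , x∈X , ≈ᴹ-refl))

  neg-involutive : ∀ α → neg (neg α) ∼ α
  neg-involutive α = vector-∼ {neg (neg α)} {α} (-ᴹ-involutive (vector α))

  coneΦ-isClosureOperator : IsClosureOperator coneΦ
  coneΦ-isClosureOperator = record
    { extensive  = coneΦ-extensive
    ; monotone   = λ {X} {Y} → coneΦ-mono {X} {Y}
    ; idempotent = λ X → (λ {x} → coneΦ-bind {coneΦ X} {X} id {x}) , λ {x} → coneΦ-extensive (coneΦ X) {x}
    }

  coneΦ-⋆ : ∀ X → (coneΦ X) ⋆ ⊆ coneΦ (X ⋆)
  coneΦ-⋆ X {y} (x , x∈ , y∼) = respect (coneΦ (X ⋆)) {neg x} {y} (∼-sym {y} {neg x} y∼)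
    (Cone⇒coneΦ (X ⋆) {neg x} (hull-map -ᴹ-linear
      (λ (α , α∈X , v≈) → neg α , (α , α∈X , ∼-refl {neg α}) , -ᴹ‿cong v≈) (coneΦ⇒Cone X {x} x∈)))

  ⋆-involutive : ∀ X → (X ⋆) ⋆ ⊆ X
  ⋆-involutive X {z} (y , (x , x∈X , y∼) , z∼) = respect X {x} {z}
    (∼-sym {z} {x} (∼-trans {z} {neg (neg x)} {x}
      (∼-trans {z} {neg y} {neg (neg x)} z∼ (neg-cong {y} {neg x} y∼)) (neg-involutive x))) x∈X

  neg-fixedPointFree : ∀ α → ¬ neg α ∼ α
  neg-fixedPointFree α (c , 0<c , eq) = vector-nonzero α (scale≈0 (proj₂ (0<1+x (proj₁ 0<c)) ∘ sym) (⟨V⟩.begin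
    (1# + c) *ₗ vector α            ⟨V⟩.≈⟨ *ₗ-distribʳ _ _ _ ⟩
    1# *ₗ vector α +ᴹ c *ₗ vector α ⟨V⟩.≈⟨ +ᴹ-cong (*ₗ-identityˡ _) (≈ᴹ-sym eq) ⟩
    vector α +ᴹ -ᴹ vector α         ⟨V⟩.≈⟨ -ᴹ‿inverseʳ _ ⟩
    0ᴹ                              ⟨V⟩.∎))

  coneΦ-isOrientedMatroid : IsOrientedMatroid coneΦ
  coneΦ-isOrientedMatroid = record
    { *-cong            = λ {α} {β} → neg-cong {α} {β}
    ; *-involutive      = neg-involutive
    ; *-fixedPointFree  = neg-fixedPointFree
    ; isClosureOperator = coneΦ-isClosureOperator
    -- The reverse inclusion is `coneΦ-⋆` for `X ⋆`, followed by the involutivity of negation.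
    ; cx-*              = λ X → (λ {x} → coneΦ-⋆ X {x}) , λ {x} x∈ →
        neg x
        , coneΦ-mono {X ⋆ ⋆} {X} (λ {z} → ⋆-involutive X {z}) {neg x}
            (coneΦ-⋆ (X ⋆) {neg x} (x , x∈ , ∼-refl {neg x}))
        , ∼-sym {neg (neg x)} {x} (neg-involutive x)
    ; cx-cancel         = coneΦ-cancel
    ; cx-exchange       = coneΦ-exchange
    ; cx-finitary       = λ X x x∈ → finitary X x (Cone-finitary X (coneΦ⇒Cone X {x} x∈))
    }
    where
    finitary : ∀ X x → ∃[ ys ] (All (_∈ X) ys × Cone (vectors (fromList ys)) (vector x)) →
               ∃[ ys ] (All (_∈ X) ys × x ∈ coneΦ (fromList ys))
    finitary X x (ys , ys∈ , h) = ys , ys∈ , Cone⇒coneΦ (fromList ys) {x} h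

  coneΦ-isReduced : IsReduced coneΦ
  coneΦ-isReduced = record
    { cx-∅         = (λ {x} x∈ → contradiction (empty (coneΦ⇒Cone ∅ {x} x∈)) (vector-nonzero x)) , λ ()
    ; cx-singleton = λ x → (λ {y} y∈ → multiple y x (Cone-adjoin {∅} {x}
        (vectors-Cone-mono {｛ x ｝} {∅ ∪ ｛ x ｝} inj₂ (coneΦ⇒Cone ｛ x ｝ {y} y∈))))
      , λ {y} → coneΦ-extensive ｛ x ｝ {y}
    }
    where
    empty : ∀ {v} → Cone (vectors ∅) v → v ≈ᴹ 0ᴹ
    empty (nil v≈0)                 = v≈0
    empty (cons _ (_ , () , _) _ _)
    multiple : ∀ y x → ∃[ s ] ∃[ u ] (0# ≤ s × Cone (vectors ∅) u × vector y ≈ᴹ s *ₗ vector x +ᴹ u) → y ∼ x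
    multiple y x (s , u , 0≤s , hu , eq) = s , (0≤s , λ 0≈s → vector-nonzero y
        (≈ᴹ-trans y≈sx (≈ᴹ-trans (*ₗ-congʳ (sym 0≈s)) (*ₗ-zeroˡ _)))) , y≈sx
      where
      y≈sx : vector y ≈ᴹ s *ₗ vector x
      y≈sx = ≈ᴹ-trans eq (≈ᴹ-trans (+ᴹ-congˡ (empty hu)) (+ᴹ-identityʳ _))

  act-∼ : ∀ w {α β} → α ∼ β → (w ∙ α) ∼ (w ∙ β)
  act-∼ w (c , 0<c , α≈cβ) = c , 0<c , ≈ᴹ-trans (act-cong w α≈cβ) (act-scale w c _)

  coneΦ-image : ∀ w X → image (w ∙_) (coneΦ X) ⊆ coneΦ (image (w ∙_) X)
  coneΦ-image w X {y} (x , x∈ , y∼) = respect (coneΦ wX) {w ∙ x} {y} (∼-sym {y} {w ∙ x} y∼)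
    (Cone⇒coneΦ wX {w ∙ x} (hull-map (act-linear w)
      (λ (α , α∈X , v≈) → w ∙ α , (α , α∈X , ∼-refl {w ∙ α}) , act-cong w v≈) (coneΦ⇒Cone X {x} x∈)))
    where wX = image (w ∙_) X

  coneΦ-isOMRS : IsOMRS coneΦ
  coneΦ-isOMRS = record
    { isOrientedMatroid = coneΦ-isOrientedMatroid
    ; isReduced         = coneΦ-isReduced
    ; equivariant       = λ w X → (λ {x} → equivariant w X {x}) , λ {x} → coneΦ-image w X {x}
    ; positive          = (λ {x} x∈ → x , Cone⇒cone (Cone-bind positive (coneΦ⇒Cone Φ̄⁺ {x} x∈)) , ∼-refl {x})
                        , λ {x} → coneΦ-extensive Φ̄⁺ {x}
    ; planar            = λ X _ → (λ x∈ → x∈) , λ x∈ → x∈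
    }
    where
    positive : ∀ {v} → vectors Φ̄⁺ v → Cone (range simple) v
    positive (α , (β , β⁺ , c , 0<c , α≈cβ) , v≈) =
      hull-resp (≈ᴹ-sym (≈ᴹ-trans v≈ α≈cβ)) (Cone-scale (proj₁ 0<c) (cone⇒Cone β⁺))
    equivariant : ∀ w X → coneΦ (image (w ∙_) X) ⊆ image (w ∙_) (coneΦ X)
    -- The preimage of `x` under `w`; `coneΦ-image` for the inverse word places it in `coneΦ X`.
    equivariant w X {x} x∈ = inverse w ∙ x
      , coneΦ-mono {image (inverse w ∙_) (image (w ∙_) X)} {X} (λ {z} → undo {z}) {inverse w ∙ x}
          (coneΦ-image (inverse w) (image (w ∙_) X) {inverse w ∙ x} (x , x∈ , ∼-refl {inverse w ∙ x}))
      , vector-∼ {x} {w ∙ (inverse w ∙ x)} (≈ᴹ-sym (act-inverseʳ w (vector x)))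
      where
      undo : image (inverse w ∙_) (image (w ∙_) X) ⊆ X
      undo {z} (y , (x , x∈X , y∼) , z∼) = respect X {x} {z} (∼-sym {z} {x}
        (∼-trans {z} {inverse w ∙ y} {x} z∼ (∼-trans {inverse w ∙ y} {inverse w ∙ (w ∙ x)} {x}
          (act-∼ (inverse w) {y} {w ∙ x} y∼)
          (vector-∼ {inverse w ∙ (w ∙ x)} {x} (act-inverseˡ w (vector x)))))) x∈X

  -- Enumeration of the roots.

  words : ℕ → List W
  words zero    = [ [] ]
  words (suc n) = cartesianProductWith _∷_ (allFin rank) (words n)

  words-complete : ∀ w → w Propositional.∈ words (length w)
  words-complete []      = here ≡.refl
  words-complete (i ∷ w) = ∈-cartesianProductWith⁺ _∷_ (∈-allFin i) (words-complete w)

  wordRoot : W → Fin rank → Root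
  wordRoot w i = root (act w (simple i)) (w , i , ≈ᴹ-refl)

  rootsOfLength : ℕ → List Root
  rootsOfLength n = cartesianProductWith wordRoot (words n) (allFin rank)

  -- Finitely many simple roots give finitely many words of each length. These lists are the stages
  -- that `topal-extension` runs through.
  roots-enumerated : ∀ α → ∃[ n ] (ListMembership._∈_ Φ̄ α (rootsOfLength n))
  roots-enumerated α@(root v (w , i , v≈)) = length w , Any.map
    (λ β≡ → ≡.subst (α ∼_) β≡ (vector-∼ {α} {wordRoot w i} v≈))
    (∈-cartesianProductWith⁺ wordRoot (words-complete w) (∈-allFin i))

  -- Finite families of roots and their dimensions.

  family : ∀ {k} → (Fin k → Root) → Subset
  family β = record
    { member  = λ x → ∃[ i ] (x ∼ β i)
    ; respect = λ {x} {y} x∼y (i , x∼) → i , ∼-trans {y} {x} {β i} (∼-sym {x} {y} x∼y) x∼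
    }

  vectors-basis⇒dimension : ∀ X {k} {b : Fin k → Carrierᴹ} → LinearlyIndependent b →
    (∀ i → vectors X (b i)) → (∀ {v} → vectors X v → SpannedBy b v) → HasDimension (span (vectors X)) k
  vectors-basis⇒dimension X indep b∈ = basis⇒dimension indep (Span-member ∘ b∈)

  family-range : ∀ {k} (β : Fin k → Root) {v} → vectors (family β) v → Cone (range (vector ∘ β)) v
  family-range β (α , (i , c , 0<c , α≈) , v≈) = hull-resp (≈ᴹ-sym (≈ᴹ-trans v≈ α≈))
    (Cone-scale (proj₁ 0<c) (Cone-member (i , ≈ᴹ-refl)))

  family-dimension : ∀ {k} (β : Fin k → Root) → LinearlyIndependent (vector ∘ β) →
                     HasDimension (span (vectors (family β))) k
  family-dimension β indep = vectors-basis⇒dimension (family β) indep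
    (λ i → β i , (i , ∼-refl {β i}) , ≈ᴹ-refl)
    (Span-range (vector ∘ β) ∘ Cone⇒Span ∘ family-range β)

  -- The two roots may be proportional, so the dimension is read off a basis extracted from them.
  pair-dimension : ∀ α β → ∃[ k ] (k ℕ.≤ 2 × HasDimension (span (vectors (｛ α ｝ ∪ ｛ β ｝))) k)
  pair-dimension α β with basis (vectors (｛ α ｝ ∪ ｛ β ｝)) g spanned
    where
    g : Fin 2 → Carrierᴹ
    g = vector α Vector.∷ vector β Vector.∷ Vector.[]
    spanned : ∀ {v} → vectors (｛ α ｝ ∪ ｛ β ｝) v → SpannedBy g v
    spanned (γ , γ∈ , v≈) = Span-range g (hull-resp (≈ᴹ-sym v≈) (point γ∈))
      where
      point : γ ∈ ｛ α ｝ ∪ ｛ β ｝ → Span (range g) (vector γ)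
      point (inj₁ (c , _ , γ≈)) = hull-resp (≈ᴹ-sym γ≈) (hull-scale _ (Span-member (zero , ≈ᴹ-refl)))
      point (inj₂ (c , _ , γ≈)) = hull-resp (≈ᴹ-sym γ≈) (hull-scale _ (Span-member (suc zero , ≈ᴹ-refl)))
  ... | k , b , k≤2 , indep , b∈ , spans = k , k≤2 , vectors-basis⇒dimension (｛ α ｝ ∪ ｛ β ｝) indep b∈ spans

  -- Uniqueness: an arbitrary structure `d` agrees with `coneΦ`.

  module Uniqueness (rank≡3 : rank ≡ 3) (clean : Clean)
                    (d : Subset → Subset) (isOMRS : IsOMRS d) where
    open IsOMRS isOMRS
    open IsOrientedMatroid isOrientedMatroid
    open IsClosureOperator isClosureOperator
    open ClosureProperties isOrientedMatroid

    -- Two roots span at most a plane, where `d` is the conic closure.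
    pair-closed : ∀ {T α β} γ → d T ⊆ T → α ∈ T → β ∈ T →
      ∃[ a ] ∃[ b ] (0# ≤ a × 0# ≤ b × vector γ ≈ᴹ a *ₗ vector α +ᴹ b *ₗ vector β) → γ ∈ T
    pair-closed {T} {α} {β} γ closed α∈T β∈T (a , b , 0≤a , 0≤b , γ≈) =
      closed {γ} (monotone {｛ α ｝ ∪ ｛ β ｝} {T} (λ {x} → ⊆T {x}) {γ}
        (proj₂ (planar (｛ α ｝ ∪ ｛ β ｝) (pair-dimension α β)) {γ}
          (Cone⇒coneΦ (｛ α ｝ ∪ ｛ β ｝) {γ} (hull-resp (≈ᴹ-sym γ≈) (hull-+
            (Cone-scale 0≤a (Cone-member (α , inj₁ (∼-refl {α}) , ≈ᴹ-refl)))
            (Cone-scale 0≤b (Cone-member (β , inj₂ (∼-refl {β}) , ≈ᴹ-refl))))))))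
      where
      ⊆T : ｛ α ｝ ∪ ｛ β ｝ ⊆ T
      ⊆T {x} (inj₁ x∼α) = respect T {α} {x} (∼-sym {x} {α} x∼α) α∈T
      ⊆T {x} (inj₂ x∼β) = respect T {β} {x} (∼-sym {x} {β} x∼β) β∈T

    -- Closedness of the positive roots in `T` is `pair-closed`. For the complement, topality turns
    -- roots outside `T` into negatives inside `T`, to which `pair-closed` applies again.
    closed-topal⇒quasitope : ∀ {T} → d T ⊆ T → Topal T → IsQuasitope T
    closed-topal⇒quasitope {T} closed topal = topal
      , (λ α β γ (_ , α∈T) (_ , β∈T) γ⁺ comb → γ⁺ , pair-closed {T} {α} {β} γ closed α∈T β∈T comb)
      , λ α β γ (α⁺ , α∉) (β⁺ , β∉) γ⁺ (a , b , 0≤a , 0≤b , γ≈) → γ⁺ , λ (_ , γ∈T) → neg∉ γ γ∈T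
          (pair-closed {T} {neg α} {neg β} (neg γ) closed
            (neg∈ α (α∉ ∘ (α⁺ ,_))) (neg∈ β (β∉ ∘ (β⁺ ,_)))
            (a , b , 0≤a , 0≤b , ≈ᴹ-trans (-ᴹ‿cong γ≈)
              (≈ᴹ-trans (≈ᴹ-sym (-ᴹ-+ᴹ _ _)) (+ᴹ-cong (-ᴹ-*ₗ a _) (-ᴹ-*ₗ b _)))))
      where
      neg∈ : ∀ α → α ∉ T → neg α ∈ T
      neg∈ α α∉T with topal α
      ... | inj₁ (α∈T , _)  = contradiction α∈T α∉T
      ... | inj₂ (_ , -α∈T) = -α∈T
      neg∉ : ∀ α → α ∈ T → neg α ∉ T
      neg∉ α α∈T with topal α
      ... | inj₁ (_ , -α∉T) = -α∉T
      ... | inj₂ (α∉T , _)  = contradiction α∈T α∉T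

    -- Otherwise some topal d-closed set would contain Y and neg x for an x ∈ coneΦ Y; by cleanness
    -- it is a tope of coneΦ, hence contains x as well.
    asymmetric⇒coneΦ⊆ : ∀ {Y} → Asymmetric (d Y) → coneΦ Y ⊆ d Y
    asymmetric⇒coneΦ⊆ {Y} asym {x} x∈ = decidable-stable em λ x∉ → absurd x∉
      (topal-extension rootsOfLength roots-enumerated (d Y′)
        (asymmetric-adjoin {Y} {x} asym x∉ , idempotent Y′))
      where
      Y′ = Y ∪ ｛ neg x ｝
      absurd : x ∉ d Y → ¬ (∃[ T ] (d Y′ ⊆ T × AsymmetricClosed d T × Topal T))
      absurd x∉ (T , ⊆T , (T-asym , T-closed) , topal) = T-asym x (x∈T , *∈⇒∈⋆ T {x} -x∈T)
        where
        Y′⊆T : Y′ ⊆ T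
        Y′⊆T {z} z∈ = ⊆T {z} (extensive Y′ {z} z∈)
        -x∈T : neg x ∈ T
        -x∈T = Y′⊆T {neg x} (inj₂ (∼-refl {neg x}))
        x∈T : x ∈ T
        coneT⊆T : coneΦ T ⊆ T
        coneT⊆T = proj₁ (proj₂ (proj₁ (clean T
          (closed-topal⇒quasitope {T} (λ {z} → proj₁ T-closed {z}) topal))))
        x∈T = coneT⊆T {x} (coneΦ-mono {Y} {T} (λ {z} z∈Y → Y′⊆T {z} (inj₁ z∈Y)) {x} x∈)

    -- The tail has at most two vectors, so `d` is conic there and its closure is a pointed cone,
    -- hence asymmetric. By independence `neg β₀` lies outside the span of the tail, so
    -- `asymmetric-adjoin` allows its opposite, the head, to be added.
    independent-asymmetric : ∀ {k} (β : Fin (suc k) → Root) → k ℕ.≤ 2 → LinearlyIndependent (vector ∘ β) →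
                             Asymmetric (d (family β))
    independent-asymmetric {k} β k≤2 indep = asymmetric-mono {d (family β)} {d (Z ∪ ｛ neg (neg β₀) ｝)}
      (λ {x} → monotone {family β} {Z ∪ ｛ neg (neg β₀) ｝} (λ {x} → covered {x}) {x})
      (asymmetric-adjoin {Z} {neg β₀} asymmetric-Z -β₀∉)
      where
      β₀ = β zero
      Z = family (tail β)
      indep′ : LinearlyIndependent (vector ∘ tail β)
      indep′ = independent-tail {b = vector ∘ β} indep
      dZ⇒Cone : ∀ {x} → x ∈ d Z → Cone (range (vector ∘ tail β)) (vector x)
      dZ⇒Cone {x} x∈ = Cone-bind (family-range (tail β))
        (coneΦ⇒Cone Z {x} (proj₁ (planar Z (k , k≤2 , family-dimension (tail β) indep′)) {x} x∈))
      covered : family β ⊆ Z ∪ ｛ neg (neg β₀) ｝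
      covered {x} (zero  , x∼) = inj₂ (∼-trans {x} {β₀} {neg (neg β₀)} x∼
        (∼-sym {neg (neg β₀)} {β₀} (neg-involutive β₀)))
      covered {x} (suc i , x∼) = inj₁ (i , x∼)
      asymmetric-Z : Asymmetric (d Z)
      asymmetric-Z x (x∈ , x∈⋆) = vector-nonzero x (independent-cone-pointed {b = vector ∘ tail β} indep′
        (dZ⇒Cone {x} x∈) (dZ⇒Cone {neg x} (∈⋆⇒*∈ (d Z) {x} x∈⋆)) (-ᴹ‿inverseʳ (vector x)))
      -β₀∉ : neg β₀ ∉ d Z
      -β₀∉ -β₀∈ = independent-head {b = vector ∘ β} indep (hull-resp
        (≈ᴹ-trans (≈ᴹ-sym (neg≈-1 _)) (-ᴹ-involutive _))
        (hull-scale {s = - 1#} _ (Cone⇒Span (dZ⇒Cone {neg β₀} -β₀∈))))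

    coneΦ⊆d-independent : ∀ {k} (β : Fin k → Root) → LinearlyIndependent (vector ∘ β) →
                          coneΦ (family β) ⊆ d (family β)
    -- The empty family has no head to split off; its span has dimension zero, so it falls under
    -- `planar`.
    coneΦ⊆d-independent {zero} β indep {x} =
      proj₂ (planar (family β) (0 , ℕ.z≤n , family-dimension β indep)) {x}
    coneΦ⊆d-independent {suc k} β indep {x} =
      asymmetric⇒coneΦ⊆ {family β} (independent-asymmetric β (ℕ.s≤s⁻¹ 1+k≤3) indep) {x}
      where
      1+k≤3 : suc k ℕ.≤ 3
      1+k≤3 = ≡.subst (suc k ℕ.≤_) rank≡3
        (independent-size {g = simple} {b = vector ∘ β} indep (root-spanned ∘ β))

    coneΦ⊆d : ∀ X → coneΦ X ⊆ d X
    coneΦ⊆d X {x} x∈ with Cone⇒cone (coneΦ⇒Cone X {x} x∈)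
    ... | n , c , a , 0≤c , a∈ , x≈ with carathéodory (vectors X) a a∈ (c , 0≤c , x≈)
    ... | k , b , indep , b∈ , e , 0≤e , x≈′ =
      monotone {family β} {X} (λ {y} → family⊆X {y}) {x}
        (coneΦ⊆d-independent β (λ r eq → indep r (≈ᴹ-trans (combination-congʳ r b≈) eq)) {x}
          (Cone⇒coneΦ (family β) {x} (hull-resp (≈ᴹ-sym x≈′) (hull-combination e b 0≤e
            (λ i → β i , (i , ∼-refl {β i}) , b≈ i)))))
      where
      -- Carathéodory's theorem returns vectors; the roots they represent are taken from the
      -- membership witnesses.
      β : Fin k → Root
      β = proj₁ ∘ b∈
      b≈ : ∀ i → b i ≈ᴹ vector (β i)
      b≈ = proj₂ ∘ proj₂ ∘ b∈
      family⊆X : family β ⊆ X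
      family⊆X {y} (i , y∼) = respect X {β i} {y} (∼-sym {y} {β i} y∼) (proj₁ (proj₂ (b∈ i)))

    -- A basis of at most two vectors falls under `planar`. A larger one has at least as many
    -- vectors as there are simple roots, so it spans every root by `independent-maximal`; since `X`
    -- is symmetric, its span is its cone.
    d⊆coneΦ-symmetric : ∀ X → (∀ {x} → x ∈ X → neg x ∈ X) → d X ⊆ coneΦ X
    d⊆coneΦ-symmetric X X-sym {x} x∈ with basis (vectors X) simple (vectors-spanned X)
    ... | k , b , _ , indep , b∈ , spans with k ℕ.≤? 2
    ... | yes k≤2 = proj₁ (planar X (k , k≤2 , vectors-basis⇒dimension X indep b∈ spans)) {x} x∈
    ... | no  k≰2 = Cone⇒coneΦ X {x} (Span⇒Cone
      (λ (α , α∈X , v≈) → neg α , X-sym {α} α∈X , -ᴹ‿cong v≈)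
      (Span-bind (λ (i , v≈) → hull-resp (≈ᴹ-sym v≈) (Span-member (b∈ i)))
        (SpannedBy⇒Span b (independent-maximal {g = simple} {b = b} indep (vectors-spanned X ∘ b∈)
          (≡.subst (ℕ._≤ k) (≡.sym rank≡3) (ℕ.≰⇒> k≰2)) (root-spanned x)))))

    coneΦ≐d : ∀ X → coneΦ X ≐ d X
    coneΦ≐d X = (λ {x} → coneΦ⊆d X {x}) , λ {x} →
      ⊇-from-symmetric coneΦ-isOrientedMatroid isOrientedMatroid
        (λ X {x} → coneΦ⊆d X {x}) (λ X X-sym {x} → d⊆coneΦ-symmetric X (λ {y} → X-sym {y}) {x}) X {x}

theorem1 : ∀ {ℓ} → (∀ {a} → ExcludedMiddle a) →
    (ℝ : RealNumbers ℓ) (Φ : RootSystem ℝ) → let open Roots Φ in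
    RootSystem.rank Φ ≡ 3 → Clean →
    ∃! (λ d d′ → ∀ X → d X ≐ d′ X) IsOMRS
theorem1 em ℝ Φ rank≡3 clean =
  coneΦ , coneΦ-isOMRS , λ {d} isOMRS → Uniqueness.coneΦ≐d rank≡3 clean d isOMRS
  where
  open Roots Φ
  open RootProperties em ℝ Φ
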